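{- Let $w\in c_1$ have (unique) reduced expression $w=s_1s_2\cdots s_n$ with $\{s_1,s_2,s_3\}=S$, and let $u\in(c_0)^w_3$. If $\mu(u,w)\neq0$, then $u$ satisfies: $|L(u)|=|R(u)|=2$, $s_1\in L(u)$, $s_n\in R(u)$, $s_2\notin L(u)$ and $s_{n-1}\notin R(u)$.
   Context: $W$ is the affine Weyl group of type $\widetilde A_2$: the Coxeter group on $S=\{r,s,t\}$ with $(rs)^3=(st)^3=(rt)^3=1$, with length $l$ and Bruhat order $\le$. For $u<w$, $\mu(u,w)$ is the coefficient of $q^{(l(w)-l(u)-1)/2}$ in the Kazhdan–Lusztig polynomial $P_{u,w}$. $c_1$ is the set of elements $w\neq e$ having a unique reduced expression (the two-sided cell of $\mathbf a$-value 1), and $c_0=W\setminus(\{e\}\cup c_1)$ (the two-sided cell of $\mathbf a$-value 3). For $w\in W$, $L(w)=\{\sigma\in S:\sigma w<w\}$, $R(w)=\{\sigma\in S: w\sigma<w\}$, and $(c_0)^w_3=\{u\in c_0: u<w,\ l(w)-l(u)=3\}$. -}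

module Defs where

open import Data.Nat as ℕ using (ℕ; zero; suc; _∸_; _≡ᵇ_; _<_; _≤_)
open import Data.Nat.DivMod using (_/_; _%_)
open import Data.Integer as ℤ using (ℤ; 0ℤ; 1ℤ)
open import Data.Bool using (if_then_else_)
open import Data.List using (List; []; _∷_; _++_; length; foldr)
open import Data.List.Relation.Unary.All using (All)
open import Data.List.Relation.Unary.Any using (Any)
open import Data.List.Relation.Unary.AllPairs using (AllPairs)
open import Data.List.Relation.Binary.Sublist.Propositional using (_⊆_)
open import Data.Product using (Σ; ∃; ∃₂; _×_; _,_; proj₁)
open import Relation.Binary.PropositionalEquality using (_≡_; _≢_)
open import Relation.Nullary using (¬_)

-- The Coxeter system (W,S) of type Ã₂, S = {r,s,t}, all m = 3.
-- Elements of W are represented by words in S; two words represent the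
-- same element iff they are related by _~_, the congruence generated by
-- the Coxeter relations  x x = e  and  x y x = y x y  (x ≠ y).

data Gen : Set where
  r s t : Gen

Word : Set
Word = List Gen

infix 4 _~_
data _~_ : Word → Word → Set where
  ~refl  : ∀ {a} → a ~ a
  ~sym   : ∀ {a b} → a ~ b → b ~ a
  ~trans : ∀ {a b c} → a ~ b → b ~ c → a ~ c
  cancel : ∀ a b x → (a ++ x ∷ x ∷ b) ~ (a ++ b)
  braid  : ∀ a b x y → x ≢ y → (a ++ x ∷ y ∷ x ∷ b) ~ (a ++ y ∷ x ∷ y ∷ b)

IsReduced : Word → Set
IsReduced y = ∀ y′ → y′ ~ y → length y ≤ length y′

Len : Word → ℕ → Set
Len u k = Σ Word λ y → y ~ u × IsReduced y × length y ≡ k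

LeftDesc : Gen → Word → Set
LeftDesc σ u = ∃₂ λ a b → Len (σ ∷ u) a × Len u b × a < b

RightDesc : Gen → Word → Set
RightDesc σ u = ∃₂ λ a b → Len (u ++ σ ∷ []) a × Len u b × a < b

-- Bruhat order (subword property): u ≤ w iff some reduced expression of
-- w has a subword which is an expression of u.
_≤B_ : Word → Word → Set
u ≤B w = Σ Word λ y → y ~ w × IsReduced y × Σ Word λ x → x ⊆ y × x ~ u

_<B_ : Word → Word → Set
u <B w = u ≤B w × ¬ (u ~ w)

-- two-sided cells c₁ (unique reduced expression, ≠ e) and c₀ (the rest)
UniqueRedExpr : Word → Set
UniqueRedExpr w = Σ Word λ y → IsReduced y × y ~ w × (∀ y′ → IsReduced y′ → y′ ~ w → y′ ≡ y)

InC1 : Word → Set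
InC1 w = ¬ (w ~ []) × UniqueRedExpr w

InC0 : Word → Set
InC0 u = ¬ (u ~ []) × ¬ InC1 u

Card2 : (Gen → Set) → Set
Card2 P = ∃₂ λ σ τ → σ ≢ τ × P σ × P τ × (∀ ρ → P ρ → ρ ≡ σ ⊎′ ρ ≡ τ)
  where
  open import Data.Sum using () renaming (_⊎_ to _⊎′_)

Poly : Set
Poly = ℕ → ℤ

0P : Poly
0P _ = 0ℤ

1P : Poly
1P zero    = 1ℤ
1P (suc _) = 0ℤ

_+P_ : Poly → Poly → Poly
(p +P p′) i = p i ℤ.+ p′ i

_-P_ : Poly → Poly → Poly
(p -P p′) i = p i ℤ.- p′ i

_·P_ : ℤ → Poly → Poly
(a ·P p) i = a ℤ.* p i

shift : ℕ → Poly → Poly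
shift zero    p i       = p i
shift (suc k) p zero    = 0ℤ
shift (suc k) p (suc i) = shift k p i

μcoef : ℕ → ℕ → Poly → ℤ
μcoef lw lu p = if ((lw ∸ lu) % 2) ≡ᵇ 1 then p ((lw ∸ lu ∸ 1) / 2) else 0ℤ

-- a summand of the KL recursion: (z , P_{z,v} , P_{x,z}), l(v) = lv,
-- contributing μ(z,v) q^{(l(w)-l(z))/2} P_{x,z} with l(w) = lv + 1.
Term : Set
Term = Σ Word λ _ → Poly × Poly

termP : ℕ → Term → Poly
termP lv (z , pz , pxz) = μcoef lv (length z) pz ·P shift ((suc lv ∸ length z) / 2) pxz

sumTerms : ℕ → List Term → Poly
sumTerms lv = foldr (λ τ acc → termP lv τ +P acc) 0P

-- Kazhdan–Lusztig polynomials, by the recursion of Kazhdan–Lusztig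
-- (1979, (2.2.c)).  KL x w p means P_{x,w} = p, where w is a reduced
-- expression.  P_{x,e} = 1 if x = e, 0 otherwise; for w = s v with
-- sw < w (i.e. s ∷ v reduced):
--   P_{x,w} = q^{1-c} P_{sx,v} + q^c P_{x,v}
--             - Σ_{z < v, sz < z} μ(z,v) q^{(l(w)-l(z))/2} P_{x,z}
-- with c = 1 if sx < x and c = 0 otherwise.  The sum runs over a list
-- of reduced expressions enumerating {z : z < v, sz < z} exactly once.

data KL : Word → Word → Poly → Set where
  KL-e   : ∀ {x} → x ~ [] → KL x [] 1P
  KL-ne  : ∀ {x} → ¬ (x ~ []) → KL x [] 0P
  KL-step : ∀ {x σ v c p₁ p₂} (ts : List Term) →
    IsReduced (σ ∷ v) →
    (LeftDesc σ x → c ≡ 1) → (¬ LeftDesc σ x → c ≡ 0) →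
    KL (σ ∷ x) v p₁ → KL x v p₂ →
    All (λ τ → let (z , pz , pxz) = τ in
                 IsReduced z × z <B v × LeftDesc σ z × KL z v pz × KL x z pxz) ts →
    (∀ z → z <B v → LeftDesc σ z → Any (λ τ → proj₁ τ ~ z) ts) →
    AllPairs (λ τ τ′ → ¬ (proj₁ τ ~ proj₁ τ′)) ts →
    KL x (σ ∷ v) ((shift (1 ∸ c) p₁ +P shift c p₂) -P sumTerms (length v) ts)

MuNonzero : Word → Word → Set
MuNonzero u w = ∃₂ λ lu p → Len u lu × KL u w p × μcoef (length w) lu p ≢ 0ℤ

{-# OPTIONS --safe #-}
module Submission where

-- Write w = a b c a b c … with n letters (the only shape allowed in c₁) and let
-- l(x) = n − 3.  The recursion for w = a v, with z the unique coatom of v having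
-- a as a left descent (v without its second letter), expresses the coefficient
-- of q in P_{x,w} as
--   [q] P_{ax,v} + [x ≤ v] − [x ≤ z]   if ax < x,
--   [ax ≤ v] + [q] P_{x,v} − [x ≤ z]   if ax > x.
-- In the second case this is 0.  In the first, the Bruhat terms cancel unless x
-- is the prefix of w of length n − 3 or n is even and x is c a b c a b … with
-- n − 2 letters and the last but one removed; by induction on n these are the
-- only x with μ(x,w) ≠ 0.  The first lies in c₁, and the descents of the second
-- can be read off.

open import Defs
open import Data.Nat using (ℕ; zero; suc; _+_; _∸_; _≤_; _<_; z≤n; s≤s; s≤s⁻¹)
open import Data.Nat.Properties using (suc-injective; _≤?_; _<?_; ≤-refl; ≤-reflexive; ≤-trans; ≤-antisym; <-irrefl; <⇒≤; <-≤-trans; ≤-<-trans; n≤1+n; m≤n⇒m≤1+n; ≰⇒>; m≤n⇒m<n∨m≡n; m≤n⇒m∸n≡0; +-∸-assoc; +-suc; +-comm)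
open import Data.Nat.DivMod using (_/_; /-monoˡ-≤)
open import Data.Nat.Tactic.RingSolver using () renaming (solve-∀ to ℕ-solve-∀)
import Data.Nat.Properties as ℕₚ
open import Data.Integer as ℤ using (ℤ; +_; -[1+_]; 0ℤ; 1ℤ; -1ℤ; ∣_∣)
import Data.Integer.Properties as ℤₚ
open import Data.Integer.Tactic.RingSolver using (solve-∀)
open import Data.Bool using (if_then_else_)
open import Data.Empty using (⊥)
open import Data.List using (List; []; _∷_; _++_; length; reverse)
open import Data.List.Properties using (length-++; ++-assoc; reverse-++; reverse-involutive; length-reverse; ∷-injective; ++-cancelˡ)
open import Data.List.Relation.Unary.All as All using (All; []; _∷_)
open import Data.List.Relation.Unary.Any using (Any; here; there)
open import Data.List.Relation.Unary.AllPairs using (AllPairs; []; _∷_)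
open import Data.List.Relation.Binary.Sublist.Propositional using (_∷_; _∷ʳ_; ⊆-refl)
open import Data.Product using (Σ; ∃₂; _×_; _,_; proj₁; proj₂)
open import Data.Sum using (_⊎_; inj₁; inj₂)
open import Function using (_∘_; case_of_)
open import Relation.Binary.PropositionalEquality using (_≡_; _≢_; refl; sym; trans; cong; cong₂; subst; subst₂; ≢-sym; module ≡-Reasoning)
open import Relation.Nullary using (¬_; Dec; yes; no; does; contradiction)
open import Relation.Nullary.Decidable using (from-yes; map′; _×-dec_; _⊎-dec_)

-- Generators and the congruence

_≟_ : (a b : Gen) → Dec (a ≡ b)
r ≟ r = yes refl
r ≟ s = no λ ()
r ≟ t = no λ ()
s ≟ r = no λ ()
s ≟ s = yes refl
s ≟ t = no λ ()
t ≟ r = no λ ()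
t ≟ s = no λ ()
t ≟ t = yes refl

all-gen? : {P : Gen → Set} → (∀ g → Dec (P g)) → Dec (∀ g → P g)
all-gen? P? = map′ (λ { (p , q , o) → λ { r → p ; s → q ; t → o } })
                   (λ h → h r , h s , h t)
                   (P? r ×-dec P? s ×-dec P? t)

-- Pigeonhole on three generators, settled by evaluating a decision procedure on all quadruples.
four-not-distinct : ∀ a b c d → a ≡ b ⊎ b ≡ c ⊎ a ≡ c ⊎ d ≡ a ⊎ d ≡ b ⊎ d ≡ c
four-not-distinct = from-yes (all-gen? λ a → all-gen? λ b → all-gen? λ c → all-gen? λ d →
  a ≟ b ⊎-dec b ≟ c ⊎-dec a ≟ c ⊎-dec d ≟ a ⊎-dec d ≟ b ⊎-dec d ≟ c)

Distinct : Gen → Gen → Gen → Set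
Distinct a b c = a ≢ b × b ≢ c × a ≢ c

rotate : ∀ {a b c} → Distinct a b c → Distinct b c a
rotate (ab , bc , ac) = bc , ≢-sym ac , ≢-sym ab

gen-cases : ∀ {a b c} → Distinct a b c → ∀ d → d ≡ a ⊎ d ≡ b ⊎ d ≡ c
gen-cases {a} {b} {c} (ab , bc , ac) d with four-not-distinct a b c d
... | inj₁ e = contradiction e ab
... | inj₂ (inj₁ e) = contradiction e bc
... | inj₂ (inj₂ (inj₁ e)) = contradiction e ac
... | inj₂ (inj₂ (inj₂ e)) = e

~-reflexive : ∀ {x y} → x ≡ y → x ~ y
~-reflexive refl = ~refl

∷-cong : ∀ σ {x y} → x ~ y → σ ∷ x ~ σ ∷ y
∷-cong σ ~refl = ~refl
∷-cong σ (~sym p) = ~sym (∷-cong σ p)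
∷-cong σ (~trans p q) = ~trans (∷-cong σ p) (∷-cong σ q)
∷-cong σ (cancel a b x) = cancel (σ ∷ a) b x
∷-cong σ (braid a b x y x≢y) = braid (σ ∷ a) b x y x≢y

σσ~ : ∀ σ x → σ ∷ σ ∷ x ~ x
σσ~ σ x = cancel [] x σ

braid₀ : ∀ {σ τ} x → σ ≢ τ → σ ∷ τ ∷ σ ∷ x ~ τ ∷ σ ∷ τ ∷ x
braid₀ x σ≢τ = braid [] x _ _ σ≢τ

move : ∀ {σ x y} → σ ∷ x ~ y → x ~ σ ∷ y
move {σ} {x} p = ~trans (~sym (σσ~ σ x)) (∷-cong σ p)

move⁻ : ∀ {σ x y} → x ~ σ ∷ y → σ ∷ x ~ y
move⁻ {σ} {x} {y} p = ~trans (∷-cong σ p) (σσ~ σ y)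

∷-injective-~ : ∀ {σ x y} → σ ∷ x ~ σ ∷ y → x ~ y
∷-injective-~ p = ~trans (move p) (σσ~ _ _)

reverse-cong : ∀ {x y} → x ~ y → reverse x ~ reverse y
reverse-cong ~refl = ~refl
reverse-cong (~sym p) = ~sym (reverse-cong p)
reverse-cong (~trans p q) = ~trans (reverse-cong p) (reverse-cong q)
reverse-cong (cancel a b x)
  rewrite reverse-++ a (x ∷ x ∷ b) | reverse-++ a b
        | reverse-++ (x ∷ x ∷ []) b | ++-assoc (reverse b) (x ∷ x ∷ []) (reverse a)
  = cancel (reverse b) (reverse a) x
reverse-cong (braid a b x y x≢y)
  rewrite reverse-++ a (x ∷ y ∷ x ∷ b) | reverse-++ a (y ∷ x ∷ y ∷ b)
        | reverse-++ (x ∷ y ∷ x ∷ []) b | reverse-++ (y ∷ x ∷ y ∷ []) b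
        | ++-assoc (reverse b) (x ∷ y ∷ x ∷ []) (reverse a)
        | ++-assoc (reverse b) (y ∷ x ∷ y ∷ []) (reverse a)
  = braid (reverse b) (reverse a) x y x≢y

-- Alcoves

-- An alcove is recorded by the three hyperplane counts in the directions of
-- its walls, indexed by the generators labelling the walls and negated for
-- every second alcove, so that crossing a wall obeys one formula everywhere.
Alcove : Set
Alcove = ℤ × ℤ × ℤ

-- The map n ↦ -1 - n: crossing a wall changes its count by one, and the sign convention alternates
-- with the alcove.
flip : ℤ → ℤ
flip (+ n) = -[1+ n ]
flip -[1+ n ] = + n

cross : Gen → Alcove → Alcove
cross r (x , y , z) = flip x , ℤ.- z , ℤ.- y
cross s (x , y , z) = ℤ.- z , flip y , ℤ.- x
cross t (x , y , z) = ℤ.- y , ℤ.- x , flip z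

coord : Gen → Alcove → ℤ
coord r (x , y , z) = x
coord s (x , y , z) = y
coord t (x , y , z) = z

norm : Alcove → ℕ
norm (x , y , z) = ∣ x ∣ + ∣ y ∣ + ∣ z ∣

alcove : Word → Alcove
alcove [] = 0ℤ , 0ℤ , 0ℤ
alcove (σ ∷ x) = cross σ (alcove x)

flip-involutive : ∀ x → flip (flip x) ≡ x
flip-involutive (+ n) = refl
flip-involutive -[1+ n ] = refl

cross-involutive : ∀ σ A → cross σ (cross σ A) ≡ A
cross-involutive r (x , y , z)
  rewrite flip-involutive x | ℤₚ.neg-involutive y | ℤₚ.neg-involutive z = refl
cross-involutive s (x , y , z)
  rewrite flip-involutive y | ℤₚ.neg-involutive x | ℤₚ.neg-involutive z = refl
cross-involutive t (x , y , z)
  rewrite flip-involutive z | ℤₚ.neg-involutive x | ℤₚ.neg-involutive y = refl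

neg-neg-flip : ∀ x → ℤ.- (ℤ.- flip x) ≡ flip (ℤ.- (ℤ.- x))
neg-neg-flip x = trans (ℤₚ.neg-involutive (flip x)) (cong flip (sym (ℤₚ.neg-involutive x)))

-- Both sides swap and flip the σ and τ coordinates and agree in the third; they differ only in
-- where the double negations sit.
cross-braid : ∀ σ τ → σ ≢ τ → ∀ A →
  cross σ (cross τ (cross σ A)) ≡ cross τ (cross σ (cross τ A))
cross-braid r r σ≢τ _ = contradiction refl σ≢τ
cross-braid s s σ≢τ _ = contradiction refl σ≢τ
cross-braid t t σ≢τ _ = contradiction refl σ≢τ
cross-braid r s _ (x , y , z) = cong₂ _,_ (sym (neg-neg-flip y)) (cong (_, _) (neg-neg-flip x))
cross-braid s r _ (x , y , z) = cong₂ _,_ (neg-neg-flip y) (cong (_, _) (sym (neg-neg-flip x)))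
cross-braid r t _ (x , y , z) = cong₂ _,_ (sym (neg-neg-flip z)) (cong (_ ,_) (neg-neg-flip x))
cross-braid t r _ (x , y , z) = cong₂ _,_ (neg-neg-flip z) (cong (_ ,_) (sym (neg-neg-flip x)))
cross-braid s t _ (x , y , z) = cong (_ ,_) (cong₂ _,_ (sym (neg-neg-flip z)) (neg-neg-flip y))
cross-braid t s _ (x , y , z) = cong (_ ,_) (cong₂ _,_ (neg-neg-flip z) (sym (neg-neg-flip y)))

alcove-cancel : ∀ a b x → alcove (a ++ x ∷ x ∷ b) ≡ alcove (a ++ b)
alcove-cancel [] b x = cross-involutive x (alcove b)
alcove-cancel (σ ∷ a) b x = cong (cross σ) (alcove-cancel a b x)

alcove-braid : ∀ a b x y → x ≢ y → alcove (a ++ x ∷ y ∷ x ∷ b) ≡ alcove (a ++ y ∷ x ∷ y ∷ b)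
alcove-braid [] b x y x≢y = cross-braid x y x≢y (alcove b)
alcove-braid (σ ∷ a) b x y x≢y = cong (cross σ) (alcove-braid a b x y x≢y)

alcove-cong : ∀ {x y} → x ~ y → alcove x ≡ alcove y
alcove-cong ~refl = refl
alcove-cong (~sym p) = sym (alcove-cong p)
alcove-cong (~trans p q) = trans (alcove-cong p) (alcove-cong q)
alcove-cong (cancel a b x) = alcove-cancel a b x
alcove-cong (braid a b x y x≢y) = alcove-braid a b x y x≢y

total : Alcove → ℤ
total (x , y , z) = x ℤ.+ y ℤ.+ z

flip≡ : ∀ x → flip x ≡ -1ℤ ℤ.- x
flip≡ (+ zero) = refl
flip≡ (+ suc n) = refl
flip≡ -[1+ n ] = refl

-- Starting from 0, the total can thus only alternate between 0 and -1. This relation among the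
-- three counts is what restricts the signs in `cross-neg`.
total-cross : ∀ σ A → total (cross σ A) ≡ -1ℤ ℤ.- total A
total-cross r (x , y , z) rewrite flip≡ x = lemma x y z
  where
  lemma : ∀ x y z → (-1ℤ ℤ.- x) ℤ.+ ℤ.- z ℤ.+ ℤ.- y ≡ -1ℤ ℤ.- (x ℤ.+ y ℤ.+ z)
  lemma = solve-∀
total-cross s (x , y , z) rewrite flip≡ y = lemma x y z
  where
  lemma : ∀ x y z → ℤ.- z ℤ.+ (-1ℤ ℤ.- y) ℤ.+ ℤ.- x ≡ -1ℤ ℤ.- (x ℤ.+ y ℤ.+ z)
  lemma = solve-∀
total-cross t (x , y , z) rewrite flip≡ z = lemma x y z
  where
  lemma : ∀ x y z → ℤ.- y ℤ.+ ℤ.- x ℤ.+ (-1ℤ ℤ.- z) ≡ -1ℤ ℤ.- (x ℤ.+ y ℤ.+ z)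
  lemma = solve-∀

total-alcove : ∀ x → total (alcove x) ≡ 0ℤ ⊎ total (alcove x) ≡ -1ℤ
total-alcove [] = inj₁ refl
total-alcove (σ ∷ x) with total-alcove x
... | inj₁ e = inj₂ (trans (total-cross σ (alcove x)) (cong (λ i → -1ℤ ℤ.- i) e))
... | inj₂ e = inj₁ (trans (total-cross σ (alcove x)) (cong (λ i → -1ℤ ℤ.- i) e))

-- The other two coordinates are only negated and exchanged, so just one absolute value changes. The
-- additive form avoids truncated subtraction.
norm-cross : ∀ σ A → norm (cross σ A) + ∣ coord σ A ∣ ≡ norm A + ∣ flip (coord σ A) ∣
norm-cross r (x , y , z) rewrite ℤₚ.∣-i∣≡∣i∣ y | ℤₚ.∣-i∣≡∣i∣ z = lemma (∣ x ∣) (∣ y ∣) (∣ z ∣) (∣ flip x ∣)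
  where
  lemma : ∀ x y z x′ → x′ + z + y + x ≡ x + y + z + x′
  lemma = ℕ-solve-∀
norm-cross s (x , y , z) rewrite ℤₚ.∣-i∣≡∣i∣ x | ℤₚ.∣-i∣≡∣i∣ z = lemma (∣ x ∣) (∣ y ∣) (∣ z ∣) (∣ flip y ∣)
  where
  lemma : ∀ x y z y′ → z + y′ + x + y ≡ x + y + z + y′
  lemma = ℕ-solve-∀
norm-cross t (x , y , z) rewrite ℤₚ.∣-i∣≡∣i∣ x | ℤₚ.∣-i∣≡∣i∣ y = lemma (∣ x ∣) (∣ y ∣) (∣ z ∣) (∣ flip z ∣)
  where
  lemma : ∀ x y z z′ → y + x + z′ + z ≡ x + y + z + z′
  lemma = ℕ-solve-∀

-- Length and left descents

-- The number of hyperplanes separating the alcove from the base alcove; `ℓ≤length` and `reduce`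
-- identify it with the Coxeter length.
ℓ : Word → ℕ
ℓ x = norm (alcove x)

ℓ-cong : ∀ {x y} → x ~ y → ℓ x ≡ ℓ y
ℓ-cong p = cong norm (alcove-cong p)

data Neg : ℤ → Set where
  neg : ∀ n → Neg -[1+ n ]

record D (σ : Gen) (x : Word) : Set where
  constructor desc
  field ℓ-drop : ℓ (σ ∷ x) < ℓ x
open D

ℓ-nonneg : ∀ σ x n → coord σ (alcove x) ≡ + n → ℓ (σ ∷ x) ≡ suc (ℓ x)
ℓ-nonneg σ x n e with norm-cross σ (alcove x)
... | h rewrite e = ℕₚ.+-cancelʳ-≡ n _ _ (trans h (+-suc (ℓ x) n))

ℓ-neg : ∀ σ x n → coord σ (alcove x) ≡ -[1+ n ] → suc (ℓ (σ ∷ x)) ≡ ℓ x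
ℓ-neg σ x n e with norm-cross σ (alcove x)
... | h rewrite e = ℕₚ.+-cancelʳ-≡ n _ _ (trans (sym (+-suc (ℓ (σ ∷ x)) n)) h)

-- `flip` raises the absolute value of a nonnegative coordinate and lowers that of a negative one,
-- so the sign of the σ coordinate decides the descent.
D⇒Neg : ∀ {σ x} → D σ x → Neg (coord σ (alcove x))
D⇒Neg {σ} {x} (desc d) with coord σ (alcove x) in e
... | + n = contradiction (≤-trans (≤-reflexive (cong suc (sym (ℓ-nonneg σ x n e)))) d)
                          (λ h → <-irrefl refl (≤-trans (n≤1+n _) h))
... | -[1+ n ] = neg n

Neg⇒D : ∀ {σ x} → Neg (coord σ (alcove x)) → D σ x
Neg⇒D {σ} {x} p with coord σ (alcove x) in e
Neg⇒D {σ} {x} (neg n) | -[1+ n ] = desc (≤-reflexive (ℓ-neg σ x n e))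

abstract
  D? : ∀ σ x → Dec (D σ x)
  D? σ x = map′ desc ℓ-drop (ℓ (σ ∷ x) <? ℓ x)

D-suc : ∀ {σ x} → D σ x → suc (ℓ (σ ∷ x)) ≡ ℓ x
D-suc {σ} {x} d with coord σ (alcove x) in e | D⇒Neg d
... | -[1+ n ] | neg n = ℓ-neg σ x n e

¬D-suc : ∀ {σ x} → ¬ D σ x → ℓ (σ ∷ x) ≡ suc (ℓ x)
¬D-suc {σ} {x} ¬d with coord σ (alcove x) in e
... | + n = ℓ-nonneg σ x n e
... | -[1+ n ] = contradiction (desc (≤-reflexive (ℓ-neg σ x n e))) ¬d

D-cong : ∀ {σ x y} → x ~ y → D σ x → D σ y
D-cong {σ} p (desc d) = desc (subst₂ _<_ (ℓ-cong (∷-cong σ p)) (ℓ-cong p) d)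

¬D-[] : ∀ {σ} → ¬ D σ []
¬D-[] (desc ())

ℓ-∷≤ : ∀ σ x → ℓ (σ ∷ x) ≤ suc (ℓ x)
ℓ-∷≤ σ x with D? σ x
... | yes (desc d) = m≤n⇒m≤1+n (<⇒≤ d)
... | no ¬d = ≤-reflexive (¬D-suc ¬d)

ℓ≤length : ∀ x → ℓ x ≤ length x
ℓ≤length [] = z≤n
ℓ≤length (σ ∷ x) = ≤-trans (ℓ-∷≤ σ x) (s≤s (ℓ≤length x))

D-via : ∀ {σ x y} → x ~ σ ∷ y → ℓ y < ℓ x → D σ x
D-via p h = desc (≤-<-trans (≤-reflexive (ℓ-cong (move⁻ p))) h)

¬D⇒D-∷ : ∀ {σ x} → ¬ D σ x → D σ (σ ∷ x)
¬D⇒D-∷ ¬d = D-via ~refl (≤-reflexive (sym (¬D-suc ¬d)))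

D⇒¬D-∷ : ∀ {σ x} → D σ x → ¬ D σ (σ ∷ x)
D⇒¬D-∷ {σ} {x} (desc d) (desc d′) =
  <-irrefl refl (<-≤-trans d (≤-trans (≤-reflexive (sym (ℓ-cong (σσ~ σ x)))) (<⇒≤ d′)))

-- Two negative coordinates force the third to be positive, as the total is 0 or -1.
cross-neg : ∀ σ τ A → σ ≢ τ → total A ≡ 0ℤ ⊎ total A ≡ -1ℤ →
  Neg (coord σ A) → Neg (coord τ A) →
  Neg (coord τ (cross σ A)) × Neg (coord σ (cross τ (cross σ A)))
cross-neg r r A σ≢τ _ _ _ = contradiction refl σ≢τ
cross-neg s s A σ≢τ _ _ _ = contradiction refl σ≢τ
cross-neg t t A σ≢τ _ _ _ = contradiction refl σ≢τ
cross-neg r s (_ , _ , + suc k) _ _ (neg m) (neg n) = neg k , neg n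
cross-neg r s (_ , _ , + zero) _ (inj₁ ()) (neg m) (neg n)
cross-neg r s (_ , _ , + zero) _ (inj₂ ()) (neg m) (neg n)
cross-neg r s (_ , _ , -[1+ k ]) _ (inj₁ ()) (neg m) (neg n)
cross-neg r s (_ , _ , -[1+ k ]) _ (inj₂ ()) (neg m) (neg n)
cross-neg s r (_ , _ , + suc k) _ _ (neg m) (neg n) = neg k , neg n
cross-neg s r (_ , _ , + zero) _ (inj₁ ()) (neg m) (neg n)
cross-neg s r (_ , _ , + zero) _ (inj₂ ()) (neg m) (neg n)
cross-neg s r (_ , _ , -[1+ k ]) _ (inj₁ ()) (neg m) (neg n)
cross-neg s r (_ , _ , -[1+ k ]) _ (inj₂ ()) (neg m) (neg n)
cross-neg r t (_ , + suc k , _) _ _ (neg m) (neg n) = neg k , neg n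
cross-neg r t (_ , + zero , _) _ (inj₁ ()) (neg m) (neg n)
cross-neg r t (_ , + zero , _) _ (inj₂ ()) (neg m) (neg n)
cross-neg r t (_ , -[1+ k ] , _) _ (inj₁ ()) (neg m) (neg n)
cross-neg r t (_ , -[1+ k ] , _) _ (inj₂ ()) (neg m) (neg n)
cross-neg t r (_ , + suc k , _) _ _ (neg m) (neg n) = neg k , neg n
cross-neg t r (_ , + zero , _) _ (inj₁ ()) (neg m) (neg n)
cross-neg t r (_ , + zero , _) _ (inj₂ ()) (neg m) (neg n)
cross-neg t r (_ , -[1+ k ] , _) _ (inj₁ ()) (neg m) (neg n)
cross-neg t r (_ , -[1+ k ] , _) _ (inj₂ ()) (neg m) (neg n)
cross-neg s t (+ suc k , _ , _) _ _ (neg m) (neg n) = neg k , neg n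
cross-neg s t (+ zero , _ , _) _ (inj₁ ()) (neg m) (neg n)
cross-neg s t (+ zero , _ , _) _ (inj₂ ()) (neg m) (neg n)
cross-neg s t (-[1+ k ] , _ , _) _ (inj₁ ()) (neg m) (neg n)
cross-neg s t (-[1+ k ] , _ , _) _ (inj₂ ()) (neg m) (neg n)
cross-neg t s (+ suc k , _ , _) _ _ (neg m) (neg n) = neg k , neg n
cross-neg t s (+ zero , _ , _) _ (inj₁ ()) (neg m) (neg n)
cross-neg t s (+ zero , _ , _) _ (inj₂ ()) (neg m) (neg n)
cross-neg t s (-[1+ k ] , _ , _) _ (inj₁ ()) (neg m) (neg n)
cross-neg t s (-[1+ k ] , _ , _) _ (inj₂ ()) (neg m) (neg n)

-- With both descents, the longest element of the subgroup generated by σ and τ can be split off on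
-- the left, one length-lowering letter at a time.
dihedral : ∀ {σ τ} x → σ ≢ τ → D σ x → D τ x → D τ (σ ∷ x) × D σ (τ ∷ σ ∷ x)
dihedral {σ} {τ} x σ≢τ d d′
  with cross-neg σ τ (alcove x) σ≢τ (total-alcove x) (D⇒Neg d) (D⇒Neg d′)
... | p , q = Neg⇒D p , Neg⇒D q

record Reduced (y : Word) : Set where
  constructor red
  field ℓ≡length : ℓ y ≡ length y
open Reduced

reduced-tail : ∀ {σ y} → Reduced (σ ∷ y) → Reduced y
reduced-tail {σ} {y} (red e) =
  red (≤-antisym (ℓ≤length y) (s≤s⁻¹ (≤-trans (≤-reflexive (sym e)) (ℓ-∷≤ σ y))))

reduced-head : ∀ {σ y} → Reduced (σ ∷ y) → D σ (σ ∷ y)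
reduced-head {σ} {y} (red e) = D-via ~refl (≤-trans (s≤s (ℓ≤length y)) (≤-reflexive (sym e)))

three-descents : ∀ {σ τ} x → σ ≢ τ → D σ x → D τ x →
  x ~ σ ∷ τ ∷ σ ∷ (σ ∷ τ ∷ σ ∷ x) × 3 + ℓ (σ ∷ τ ∷ σ ∷ x) ≡ ℓ x
three-descents {σ} {τ} x σ≢τ d d′ with dihedral x σ≢τ d d′
... | e , f = move (move (move ~refl)) ,
              trans (cong (suc ∘ suc) (D-suc f)) (trans (cong suc (D-suc e)) (D-suc d))

-- If the first letter τ is not σ, `dihedral` and two recursive calls give y ~ τ σ τ g″, which a
-- braid move turns into a word starting with σ. The second call is on a word that is no subterm,
-- hence the bound `n`.
exchange : ∀ n {σ} y → length y ≤ n → Reduced y → D σ y →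
  Σ Word λ y′ → y ~ σ ∷ y′ × suc (length y′) ≡ length y
exchange n [] _ _ d = contradiction d ¬D-[]
exchange (suc n) {σ} (τ ∷ g) (s≤s |g|≤n) ρ d with σ ≟ τ
... | yes refl = g , ~refl , refl
... | no σ≢τ with dihedral (τ ∷ g) (≢-sym σ≢τ) (reduced-head ρ) d
... | d₁ , d₂ with exchange n g |g|≤n (reduced-tail ρ) (D-cong (σσ~ τ g) d₁)
... | g′ , g~ , |g′|
  with exchange n g′ (≤-trans (n≤1+n _) (≤-trans (≤-reflexive |g′|) |g|≤n))
         (reduced-tail {σ} (red (trans (ℓ-cong (~sym g~)) (trans (ℓ≡length (reduced-tail ρ)) (sym |g′|)))))
         (D-cong (move⁻ (~trans (σσ~ τ g) g~)) d₂)
... | g″ , g′~ , |g″| = τ ∷ σ ∷ g″ ,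
  ~trans (∷-cong τ (~trans g~ (∷-cong σ g′~))) (braid₀ g″ (≢-sym σ≢τ)) ,
  cong suc (trans (cong suc |g″|) |g′|)

reduce : ∀ x → Σ Word λ y → y ~ x × length y ≡ ℓ x
reduce [] = [] , ~refl , refl
reduce (σ ∷ x) with reduce x
... | y , y~x , |y| with D? σ x
...   | no ¬d = σ ∷ y , ∷-cong σ y~x , trans (cong suc |y|) (sym (¬D-suc ¬d))
...   | yes d with exchange (length y) y ≤-refl (red (trans (ℓ-cong y~x) (sym |y|))) (D-cong (~sym y~x) d)
...     | y′ , y~ , |y′| = y′ , ~sym (move⁻ (~trans (~sym y~x) y~)) ,
                           suc-injective (trans |y′| (trans |y| (sym (D-suc d))))

IsReduced⇒Reduced : ∀ {y} → IsReduced y → Reduced y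
IsReduced⇒Reduced {y} min with reduce y
... | y₀ , y₀~y , |y₀| = red (≤-antisym (ℓ≤length y) (≤-trans (min y₀ y₀~y) (≤-reflexive |y₀|)))

Reduced⇒IsReduced : ∀ {y} → Reduced y → IsReduced y
Reduced⇒IsReduced (red e) y′ y′~y =
  ≤-trans (≤-reflexive (trans (sym e) (ℓ-cong (~sym y′~y)))) (ℓ≤length y′)

Len⇒ℓ : ∀ {u k} → Len u k → k ≡ ℓ u
Len⇒ℓ (y , y~u , min , |y|) =
  trans (sym |y|) (trans (sym (ℓ≡length (IsReduced⇒Reduced min))) (ℓ-cong y~u))

Len-ℓ : ∀ u → Len u (ℓ u)
Len-ℓ u with reduce u
... | y , y~u , |y| = y , y~u , Reduced⇒IsReduced (red (trans (ℓ-cong y~u) (sym |y|))) , |y|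

LeftDesc⇒D : ∀ {σ u} → LeftDesc σ u → D σ u
LeftDesc⇒D (_ , _ , la , lb , a<b) = desc (subst₂ _<_ (Len⇒ℓ la) (Len⇒ℓ lb) a<b)

D⇒LeftDesc : ∀ {σ u} → D σ u → LeftDesc σ u
D⇒LeftDesc {σ} {u} (desc d) = _ , _ , Len-ℓ (σ ∷ u) , Len-ℓ u , d

-- Reversal is inversion in W; its invariance of length lets right descents of u be treated as left
-- descents of `reverse u`.
ℓ-reverse≤ : ∀ x → ℓ (reverse x) ≤ ℓ x
ℓ-reverse≤ x with reduce x
... | y , y~x , |y| = ≤-trans (≤-reflexive (ℓ-cong (reverse-cong (~sym y~x))))
  (≤-trans (ℓ≤length (reverse y)) (≤-reflexive (trans (length-reverse y) |y|)))

ℓ-reverse : ∀ x → ℓ (reverse x) ≡ ℓ x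
ℓ-reverse x = ≤-antisym (ℓ-reverse≤ x)
  (≤-trans (≤-reflexive (cong ℓ (sym (reverse-involutive x)))) (ℓ-reverse≤ (reverse x)))

ℓ-∷ʳ : ∀ u σ → ℓ (u ++ σ ∷ []) ≡ ℓ (σ ∷ reverse u)
ℓ-∷ʳ u σ = trans (sym (ℓ-reverse (u ++ σ ∷ []))) (cong ℓ (reverse-++ u (σ ∷ [])))

RightDesc⇒D : ∀ {σ u} → RightDesc σ u → D σ (reverse u)
RightDesc⇒D {σ} {u} (_ , _ , la , lb , a<b) =
  desc (subst₂ _<_ (trans (Len⇒ℓ la) (ℓ-∷ʳ u σ)) (trans (Len⇒ℓ lb) (sym (ℓ-reverse u))) a<b)

D⇒RightDesc : ∀ {σ u} → D σ (reverse u) → RightDesc σ u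
D⇒RightDesc {σ} {u} (desc d) = _ , _ , Len-ℓ (u ++ σ ∷ []) , Len-ℓ u ,
  subst₂ _<_ (sym (ℓ-∷ʳ u σ)) (ℓ-reverse u) d

-- Removing σ and then exchanging roles as (σ,τ,ρ) ↦ (τ,ρ,σ) reproduces the
-- hypotheses for a shorter element.
no-cyclic-descents : ∀ n {σ τ ρ} x → ℓ x ≤ n → Distinct σ τ ρ →
  D σ x → D τ x → ¬ D ρ (σ ∷ x)
no-cyclic-descents zero x ℓx≤0 _ (desc d) = contradiction (<-≤-trans d ℓx≤0) λ ()
no-cyclic-descents (suc n) {σ} x ℓx≤ δ dσ dτ dρ with dihedral x (proj₁ δ) dσ dτ
... | dτ′ , dσ′ =
  no-cyclic-descents n (σ ∷ x) (s≤s⁻¹ (≤-trans (ℓ-drop dσ) ℓx≤)) (rotate δ) dτ′ dρ dσ′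

-- By `dihedral` a third descent ρ would remain a descent of `σ ∷ x`, which `no-cyclic-descents`
-- forbids.
at-most-two-descents : ∀ {σ τ ρ} x → Distinct σ τ ρ → D σ x → D τ x → ¬ D ρ x
at-most-two-descents x δ@(στ , τρ , σρ) dσ dτ dρ =
  no-cyclic-descents (ℓ x) x ≤-refl δ dσ dτ (proj₁ (dihedral x σρ dσ dρ))

-- Bruhat order

-- The shorter of `x` and `σ ∷ x`. These idempotent operators satisfy the braid relations (a 0-Hecke
-- action), so `LE` will not depend on the reduced expression chosen.
down : Gen → Word → Word
down σ x = if does (D? σ x) then σ ∷ x else x

down-D : ∀ {σ x} → D σ x → down σ x ≡ σ ∷ x
down-D {σ} {x} d with D? σ x
... | yes _ = refl
... | no ¬d = contradiction d ¬d

down-¬D : ∀ {σ x} → ¬ D σ x → down σ x ≡ x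
down-¬D {σ} {x} ¬d with D? σ x
... | yes d = contradiction d ¬d
... | no _ = refl

down-cong : ∀ σ {x y} → x ~ y → down σ x ~ down σ y
down-cong σ {x} {y} p with D? σ x
... | yes d rewrite down-D (D-cong p d) = ∷-cong σ p
... | no ¬d rewrite down-¬D (¬d ∘ D-cong (~sym p)) = p

-- Three drops put σ τ σ at the front of x; the braid move then puts τ there, and the count shows
-- that removing it lowers the length.
dihedral⁻ : ∀ {σ τ} x → σ ≢ τ → D σ x → D τ (σ ∷ x) → D σ (τ ∷ σ ∷ x) → D τ x
dihedral⁻ {σ} {τ} x σ≢τ d d₁ d₂ = D-via (~trans (move (move (move ~refl))) (braid₀ _ σ≢τ)) (begin-strict
  ℓ (σ ∷ τ ∷ (σ ∷ τ ∷ σ ∷ x))      ≤⟨ ℓ-∷≤ σ (τ ∷ σ ∷ τ ∷ σ ∷ x) ⟩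
  suc (ℓ (τ ∷ (σ ∷ τ ∷ σ ∷ x)))    ≤⟨ s≤s (ℓ-∷≤ τ (σ ∷ τ ∷ σ ∷ x)) ⟩
  2 + ℓ (σ ∷ τ ∷ σ ∷ x)            ≡⟨ cong suc (D-suc d₂) ⟩
  suc (ℓ (τ ∷ σ ∷ x))              ≡⟨ D-suc d₁ ⟩
  ℓ (σ ∷ x)                        <⟨ ℓ-drop d ⟩
  ℓ x                              ∎)
  where open ℕₚ.≤-Reasoning

private
  -- Both sides stop after at most two drops: a third would make τ a descent of x by `dihedral⁻`.
  down-braid-mixed : ∀ {σ τ} x → σ ≢ τ → D σ x → ¬ D τ x →
    down σ (down τ (down σ x)) ~ down τ (down σ (down τ x))
  down-braid-mixed {σ} {τ} x σ≢τ d ¬d rewrite down-D d | down-¬D ¬d | down-D d with D? τ (σ ∷ x)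
  ... | no ¬d₁ rewrite down-¬D (D⇒¬D-∷ d) = ~refl
  ... | yes d₁ rewrite down-¬D (¬d ∘ dihedral⁻ x σ≢τ d d₁) = ~refl

down-braid : ∀ {σ τ} x → σ ≢ τ → down σ (down τ (down σ x)) ~ down τ (down σ (down τ x))
down-braid {σ} {τ} x σ≢τ = cases (D? σ x) (D? τ x)
  where
  cases : Dec (D σ x) → Dec (D τ x) → down σ (down τ (down σ x)) ~ down τ (down σ (down τ x))
  cases (yes d) (no ¬d) = down-braid-mixed x σ≢τ d ¬d
  cases (no ¬d) (yes d) = ~sym (down-braid-mixed x (≢-sym σ≢τ) d ¬d)
  cases (no ¬d) (no ¬d′) rewrite down-¬D ¬d | down-¬D ¬d′ | down-¬D ¬d | down-¬D ¬d′ = ~refl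
  cases (yes d) (yes d′) with dihedral x σ≢τ d d′ | dihedral x (≢-sym σ≢τ) d′ d
  ... | e , f | g , h
    rewrite down-D d | down-D d′ | down-D e | down-D g | down-D f | down-D h = braid₀ x σ≢τ

-- The Bruhat order for a reduced second argument, by the lifting property.
LE : Word → Word → Set
LE x [] = ℓ x ≡ 0
LE x (σ ∷ y) = LE (down σ x) y

LE? : ∀ x y → Dec (LE x y)
LE? x [] = ℓ x ℕₚ.≟ 0
LE? x (σ ∷ y) = LE? (down σ x) y

LE-congˡ : ∀ {x x′} y → x ~ x′ → LE x y → LE x′ y
LE-congˡ [] p h = trans (sym (ℓ-cong p)) h
LE-congˡ (σ ∷ y) p h = LE-congˡ y (down-cong σ p) h

LE-D : ∀ {σ x} y → D σ x → LE x (σ ∷ y) → LE (σ ∷ x) y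
LE-D y d = subst (λ x → LE x y) (down-D d)

LE-¬D : ∀ {σ x} y → ¬ D σ x → LE x (σ ∷ y) → LE x y
LE-¬D y ¬d = subst (λ x → LE x y) (down-¬D ¬d)

LE-D⁻ : ∀ {σ x} y → D σ x → LE (σ ∷ x) y → LE x (σ ∷ y)
LE-D⁻ y d = subst (λ x → LE x y) (sym (down-D d))

LE-¬D⁻ : ∀ {σ x} y → ¬ D σ x → LE x y → LE x (σ ∷ y)
LE-¬D⁻ y ¬d = subst (λ x → LE x y) (sym (down-¬D ¬d))

LE⇒ℓ≤ : ∀ {x} y → LE x y → ℓ x ≤ length y
LE⇒ℓ≤ [] h = ≤-reflexive h
LE⇒ℓ≤ {x} (σ ∷ y) h with D? σ x
... | yes d = ≤-trans (≤-reflexive (sym (D-suc d))) (s≤s (LE⇒ℓ≤ y h))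
... | no ¬d = m≤n⇒m≤1+n (LE⇒ℓ≤ y h)

-- Each letter of y lowers the length by at most one, so with this length x must drop at every
-- letter and is spelled by y.
LE⇒~ : ∀ {x} y → LE x y → length y ≤ ℓ x → x ~ y
LE⇒~ {x} [] h _ with reduce x
... | [] , x~ , _ = ~sym x~
... | _ ∷ _ , _ , e = contradiction (trans e h) λ ()
LE⇒~ {x} (σ ∷ y) h |y|≤ with D? σ x
... | yes d = move (LE⇒~ y h (s≤s⁻¹ (≤-trans |y|≤ (≤-reflexive (sym (D-suc d))))))
... | no ¬d = contradiction (≤-trans |y|≤ (LE⇒ℓ≤ y h)) (<-irrefl refl)

LE-refl : ∀ {x y} → Reduced y → x ~ y → LE x y
LE-refl {y = []} ρ p = ℓ-cong p
LE-refl {y = σ ∷ y} ρ p =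
  LE-D⁻ y (D-cong (~sym p) (reduced-head ρ)) (LE-refl (reduced-tail ρ) (move⁻ p))

LE-braid : ∀ {σ τ x} y → σ ≢ τ → LE x (σ ∷ τ ∷ σ ∷ y) → LE x (τ ∷ σ ∷ τ ∷ y)
LE-braid {x = x} y σ≢τ = LE-congˡ y (down-braid x σ≢τ)

-- When the first letters differ, both are descents, so the element is σ τ σ g. The passage from y
-- to z goes through σ τ σ g and τ σ τ g, by induction on the tails and `LE-braid` in between.
LE-congʳ : ∀ n {x} y z → length y ≤ n → Reduced y → Reduced z → y ~ z → LE x y → LE x z
LE-congʳ n [] [] _ _ _ _ h = h
LE-congʳ n [] (τ ∷ z) _ _ ρ y~z _ = contradiction (trans (ℓ-cong y~z) (ℓ≡length ρ)) λ ()
LE-congʳ n (σ ∷ y) [] _ ρ _ y~z _ = contradiction (trans (ℓ-cong (~sym y~z)) (ℓ≡length ρ)) λ ()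
LE-congʳ (suc n) {x} (σ ∷ y) (τ ∷ z) (s≤s |y|≤n) ρy ρz y~z h with σ ≟ τ
... | yes refl = LE-congʳ n y z |y|≤n (reduced-tail ρy) (reduced-tail ρz) (∷-injective-~ y~z) h
... | no σ≢τ with three-descents (σ ∷ y) σ≢τ (reduced-head ρy) (D-cong (~sym y~z) (reduced-head ρz))
                | reduce (σ ∷ τ ∷ σ ∷ σ ∷ y)
... | y~ , drop | g , g~ , |g| =
  LE-congʳ n (σ ∷ τ ∷ g) z (≤-trans (≤-reflexive 2+|g|) |y|≤n) (reduced-tail ρτ) (reduced-tail ρz)
    (∷-injective-~ (~trans (~sym (~trans σy~ (braid₀ g σ≢τ))) y~z))
    (LE-braid {x = x} g σ≢τ
      (LE-congʳ n {x = down σ x} y (τ ∷ σ ∷ g) |y|≤n (reduced-tail ρy) (reduced-tail ρσ)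
        (∷-injective-~ σy~) h))
  where
  σy~ : σ ∷ y ~ σ ∷ τ ∷ σ ∷ g
  σy~ = ~trans y~ (∷-cong σ (∷-cong τ (∷-cong σ (~sym g~))))
  3+|g| : 3 + length g ≡ ℓ (σ ∷ y)
  3+|g| = trans (cong (suc ∘ suc ∘ suc) |g|) drop
  2+|g| : 2 + length g ≡ length y
  2+|g| = suc-injective (trans 3+|g| (ℓ≡length ρy))
  ρσ : Reduced (σ ∷ τ ∷ σ ∷ g)
  ρσ = red (trans (ℓ-cong (~sym σy~)) (sym 3+|g|))
  ρτ : Reduced (τ ∷ σ ∷ τ ∷ g)
  ρτ = red (trans (ℓ-cong (~sym (~trans σy~ (braid₀ g σ≢τ)))) (sym 3+|g|))

-- Cyclic words and their coatoms

cyc : Gen → Gen → Gen → ℕ → Word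
cyc a b c zero = []
cyc a b c (suc n) = a ∷ cyc b c a n

length-cyc : ∀ a b c n → length (cyc a b c n) ≡ n
length-cyc a b c zero = refl
length-cyc a b c (suc n) = cong suc (length-cyc b c a n)

-- By `dihedral`, a descent b besides a reproduces the situation two letters further on, and a
-- descent c becomes one of the tail, where c is the second letter. Hence prefixing the cyclic
-- predecessor always raises the length.
mutual
  cyc-reduced : ∀ {a b c} → Distinct a b c → ∀ n → Reduced (cyc a b c n)
  cyc-reduced δ zero = red refl
  cyc-reduced δ (suc n) =
    red (trans (¬D-suc (cyc-¬D-pred (rotate δ) n)) (cong suc (ℓ≡length (cyc-reduced (rotate δ) n))))

  cyc-¬D-succ : ∀ {a b c} → Distinct a b c → ∀ n → ¬ D b (cyc a b c n)
  cyc-¬D-succ δ zero d = ¬D-[] d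
  cyc-¬D-succ {a} {b} {c} δ (suc n) d
    with dihedral (cyc a b c (suc n)) (proj₁ δ) (reduced-head (cyc-reduced δ (suc n))) d
  ... | d₁ , d₂ = tail n (D-cong (σσ~ a _) d₁) (D-cong (∷-cong b (σσ~ a _)) d₂)
    where
    tail : ∀ n → D b (cyc b c a n) → D a (b ∷ cyc b c a n) → ⊥
    tail zero d₁ _ = ¬D-[] d₁
    tail (suc n) _ d₂ = cyc-¬D-succ (rotate (rotate δ)) n (D-cong (σσ~ b _) d₂)

  cyc-¬D-pred : ∀ {a b c} → Distinct a b c → ∀ n → ¬ D c (cyc a b c n)
  cyc-¬D-pred δ zero d = ¬D-[] d
  cyc-¬D-pred {a} {b} {c} δ (suc n) d
    with dihedral (cyc a b c (suc n)) (proj₂ (proj₂ δ)) (reduced-head (cyc-reduced δ (suc n))) d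
  ... | d₁ , _ = cyc-¬D-succ (rotate δ) n (D-cong (σσ~ a _) d₁)

ℓ-cyc : ∀ {a b c} → Distinct a b c → ∀ n → ℓ (cyc a b c n) ≡ n
ℓ-cyc {a} {b} {c} δ n = trans (ℓ≡length (cyc-reduced δ n)) (length-cyc a b c n)

cyc-unique : ∀ {a b c} → Distinct a b c → ∀ n {y} → Reduced y → y ~ cyc a b c n → y ≡ cyc a b c n
cyc-unique δ zero {[]} ρ p = refl
cyc-unique δ zero {σ ∷ y} ρ p = contradiction (trans (sym (ℓ≡length ρ)) (ℓ-cong p)) λ ()
cyc-unique δ (suc n) {[]} ρ p = contradiction (trans (sym (ℓ-cyc δ (suc n))) (ℓ-cong (~sym p))) λ ()
cyc-unique δ (suc n) {σ ∷ y} ρ p with gen-cases δ σ | D-cong p (reduced-head ρ)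
... | inj₁ refl | _ = cong (_ ∷_) (cyc-unique (rotate δ) n (reduced-tail ρ) (∷-injective-~ p))
... | inj₂ (inj₁ refl) | d = contradiction d (cyc-¬D-succ δ (suc n))
... | inj₂ (inj₂ refl) | d = contradiction d (cyc-¬D-pred δ (suc n))

cyc-UniqueRedExpr : ∀ {a b c} → Distinct a b c → ∀ n {u} → u ~ cyc a b c n → UniqueRedExpr u
cyc-UniqueRedExpr {a} {b} {c} δ n p = cyc a b c n , Reduced⇒IsReduced (cyc-reduced δ n) , ~sym p ,
  λ y′ ρ q → cyc-unique δ n (IsReduced⇒Reduced ρ) (~trans q p)

even≥4 : ℕ → ℕ
even≥4 zero = 4
even≥4 (suc k) = 2 + even≥4 k

-- zig a b c k is cyc a b c (even≥4 k) without its last letter but one.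
zig : Gen → Gen → Gen → ℕ → Word
zig a b c zero = a ∷ b ∷ a ∷ []
zig a b c (suc k) = a ∷ b ∷ zig c a b k

-- If a is no descent, x lies below the tail and equals it by length. Otherwise strip a and then b:
-- `dihedral` keeps a as a descent, now the second letter of the cyclic word starting with c, and
-- the argument repeats.
coatom-succ : ∀ M {a b c x} → Distinct a b c → LE x (cyc a b c (suc M)) → ℓ x ≡ M → D b x →
  x ~ cyc b c a M ⊎ (Σ ℕ λ k → suc M ≡ even≥4 k × x ~ zig a b c k × D a x)
coatom-succ M {a} {b} {c} {x} δ h ℓx db with D? a x
... | no ¬d = inj₁ (LE⇒~ (cyc b c a M) h (≤-reflexive (trans (length-cyc b c a M) (sym ℓx))))
... | yes da with dihedral x (proj₁ δ) da db
...   | db′ , da′ with M | trans (D-suc da) ℓx | trans (cong suc (D-suc db′)) (trans (D-suc da) ℓx)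
...     | zero | () | _
...     | suc zero | _ | ()
...     | suc (suc M′) | _ | ℓx″
  with coatom-succ M′ (rotate (rotate δ)) (LE-D (cyc c a b (suc M′)) db′ h)
         (suc-injective (suc-injective ℓx″)) da′
...       | inj₁ p = inj₂ (tail M′ p (suc-injective (suc-injective ℓx″)))
  where
  tail : ∀ M → b ∷ a ∷ x ~ cyc a b c M → ℓ (b ∷ a ∷ x) ≡ M →
         Σ ℕ λ k → suc (suc (suc M)) ≡ even≥4 k × x ~ zig a b c k × D a x
  tail zero p _ = contradiction (D-cong p da′) ¬D-[]
  tail (suc zero) p _ = 0 , refl , move (move p) , da
  -- Here x would be a b a b w; a braid move creates a square, leaving only 2 + M letters.
  tail (suc (suc M)) p e = contradiction short (<-irrefl refl)
    where
    w = cyc c a b M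
    x~ : x ~ b ∷ a ∷ w
    x~ = ~trans (~trans (move (move p)) (∷-cong a (braid₀ w (≢-sym (proj₁ δ)))))
                (σσ~ a (b ∷ a ∷ w))
    open ℕₚ.≤-Reasoning
    short : 4 + M < 4 + M
    short = begin-strict
      4 + M                       ≡⟨ cong (suc ∘ suc) e ⟨
      2 + ℓ (b ∷ a ∷ x)           ≡⟨ trans (cong suc (D-suc db′)) (D-suc da) ⟩
      ℓ x                         ≡⟨ ℓ-cong x~ ⟩
      ℓ (b ∷ a ∷ w)               ≤⟨ ℓ≤length (b ∷ a ∷ w) ⟩
      2 + length w                ≡⟨ cong (suc ∘ suc) (length-cyc c a b M) ⟩
      2 + M                       <⟨ s≤s (s≤s (n≤1+n (suc M))) ⟩
      4 + M                       ∎
...       | inj₂ (k , e , p , _) = inj₂ (suc k , cong (suc ∘ suc) e , move (move p) , da)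

-- The unique coatom of cyc a b c (4 + k) having c as a left descent.
coatom : Gen → Gen → Gen → ℕ → Word
coatom a b c k = a ∷ cyc c a b (2 + k)

-- Removing a leads to `coatom-succ` for the tail, whose second letter is c. Its zigzag alternative
-- would make b a descent of `a ∷ x`, against `no-cyclic-descents`.
coatom-pred : ∀ M {a b c x} → Distinct a b c → LE x (cyc a b c (suc M)) → ℓ x ≡ M → D c x →
  Σ ℕ λ k → M ≡ 3 + k × x ~ coatom a b c k
coatom-pred M {a} {b} {c} {x} δ h ℓx dc with D? a x
... | no ¬d = contradiction
  (D-cong (LE⇒~ (cyc b c a M) h (≤-reflexive (trans (length-cyc b c a M) (sym ℓx)))) dc)
  (cyc-¬D-succ (rotate δ) M)
... | yes da with dihedral x (proj₂ (proj₂ δ)) da dc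
...   | dc′ , da′ with M | trans (D-suc da) ℓx
...     | zero | ()
...     | suc M′ | ℓx′ with coatom-succ M′ (rotate δ) h (suc-injective ℓx′) dc′
...       | inj₂ (_ , _ , _ , db) = contradiction db
              (no-cyclic-descents (ℓ x) x ≤-refl (proj₂ (proj₂ δ) , ≢-sym (proj₁ (proj₂ δ)) , proj₁ δ) da dc)
...       | inj₁ p = tail M′ p
  where
  tail : ∀ M → a ∷ x ~ cyc c a b M → Σ ℕ λ k → suc M ≡ 3 + k × x ~ coatom a b c k
  tail zero p = contradiction (D-cong p dc′) ¬D-[]
  tail (suc zero) p = contradiction (D-cong (move⁻ p) da′) ¬D-[]
  tail (suc (suc k)) p = k , refl , move p

coatom-reduced : ∀ {a b c} → Distinct a b c → ∀ k → Reduced (coatom a b c k)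
coatom-reduced δ k = red (trans (¬D-suc (cyc-¬D-succ (rotate (rotate δ)) (2 + k)))
  (cong suc (ℓ≡length (cyc-reduced (rotate (rotate δ)) (2 + k)))))

coatom-braid : ∀ {a b c} → Distinct a b c → ∀ k → coatom a b c k ~ c ∷ a ∷ c ∷ cyc b c a k
coatom-braid (_ , _ , ac) k = braid₀ _ ac

coatom-braid-reduced : ∀ {a b c} → Distinct a b c → ∀ k → Reduced (c ∷ a ∷ c ∷ cyc b c a k)
coatom-braid-reduced δ k = red (trans (ℓ-cong (~sym (coatom-braid δ k))) (ℓ≡length (coatom-reduced δ k)))

coatom-D : ∀ {a b c} → Distinct a b c → ∀ k → D c (coatom a b c k)
coatom-D δ k = D-cong (~sym (coatom-braid δ k)) (reduced-head (coatom-braid-reduced δ k))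

ℓ-coatom : ∀ {a b c} → Distinct a b c → ∀ k → ℓ (coatom a b c k) ≡ 3 + k
ℓ-coatom {a} {b} {c} δ k = trans (ℓ≡length (coatom-reduced δ k)) (cong (suc ∘ suc ∘ suc) (length-cyc b c a k))

coatom-LE : ∀ {a b c} → Distinct a b c → ∀ k {x} → x ~ coatom a b c k → LE x (cyc a b c (4 + k))
coatom-LE {a} {b} {c} δ k {x} p = LE-D⁻ y (D-cong (~sym p) (reduced-head (coatom-reduced δ k)))
  (LE-congˡ y (~sym (move⁻ p))
    (LE-¬D⁻ z (cyc-¬D-pred δ″ (2 + k)) (LE-refl (cyc-reduced δ″ (2 + k)) ~refl)))
  where
  δ″ = rotate (rotate δ)
  y = cyc b c a (3 + k)
  z = cyc c a b (2 + k)

coatom-<B : ∀ {a b c} → Distinct a b c → ∀ k → coatom a b c k <B cyc a b c (4 + k)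
coatom-<B {a} {b} {c} δ k =
  (cyc a b c (4 + k) , ~refl , Reduced⇒IsReduced (cyc-reduced δ (4 + k)) ,
   coatom a b c k , refl ∷ (b ∷ʳ ⊆-refl) , ~refl) ,
  λ p → contradiction (trans (sym (ℓ-coatom δ k)) (trans (ℓ-cong p) (ℓ-cyc δ (4 + k))))
                      (ℕₚ.1+n≢n ∘ sym)

-- The coefficients of q⁰ and q¹

χ : Word → Word → ℤ
χ x y = if does (LE? x y) then 1ℤ else 0ℤ

χ-LE : ∀ {x y} → LE x y → χ x y ≡ 1ℤ
χ-LE {x} {y} h with LE? x y
... | yes _ = refl
... | no ¬h = contradiction h ¬h

χ-¬LE : ∀ {x y} → ¬ LE x y → χ x y ≡ 0ℤ
χ-¬LE {x} {y} ¬h with LE? x y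
... | yes h = contradiction h ¬h
... | no _ = refl

χ-⇔ : ∀ {x y x′ y′} → (LE x y → LE x′ y′) → (LE x′ y′ → LE x y) → χ x y ≡ χ x′ y′
χ-⇔ {x} {y} {x′} {y′} f g with LE? x y
... | yes h = sym (χ-LE {x′} {y′} (f h))
... | no ¬h = sym (χ-¬LE {x′} {y′} (¬h ∘ g))

χ-congʳ : ∀ {x y z} → Reduced y → Reduced z → y ~ z → χ x y ≡ χ x z
χ-congʳ {x} {y} {z} ρy ρz p = χ-⇔ {x} {y} {x} {z}
  (LE-congʳ (length y) y z ≤-refl ρy ρz p) (LE-congʳ (length z) z y ≤-refl ρz ρy (~sym p))

shift≥1-0 : ∀ {k} p → 1 ≤ k → shift k p 0 ≡ 0ℤ
shift≥1-0 {suc k} p _ = refl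

shift≥2-1 : ∀ {k} p → 2 ≤ k → shift k p 1 ≡ 0ℤ
shift≥2-1 {suc (suc k)} p _ = refl
shift≥2-1 {suc zero} p (s≤s ())

-- Here d = l(v) − l(z).
μ-shift-0 : ∀ d (pz pxz : Poly) → μcoef d 0 pz ℤ.* shift (suc d / 2) pxz 0 ≡ 0ℤ
μ-shift-0 zero pz pxz = refl
μ-shift-0 (suc d) pz pxz =
  trans (cong (μcoef (suc d) 0 pz ℤ.*_) (shift≥1-0 pxz (/-monoˡ-≤ 2 (s≤s (s≤s (z≤n {d}))))))
        (ℤₚ.*-zeroʳ (μcoef (suc d) 0 pz))

-- Gaps 0 and 2 are killed by the parity condition in μ, and gaps of at least 3 shift by at least
-- q².
μ-shift-1 : ∀ d (pz pxz : Poly) → d ≢ 1 → μcoef d 0 pz ℤ.* shift (suc d / 2) pxz 1 ≡ 0ℤ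
μ-shift-1 0 pz pxz _ = refl
μ-shift-1 1 pz pxz d≢1 = contradiction refl d≢1
μ-shift-1 2 pz pxz _ = refl
μ-shift-1 (suc (suc (suc d))) pz pxz _ =
  trans (cong (μcoef (3 + d) 0 pz ℤ.*_)
          (shift≥2-1 pxz (/-monoˡ-≤ 2 (s≤s (s≤s (s≤s (s≤s (z≤n {d}))))))))
        (ℤₚ.*-zeroʳ (μcoef (3 + d) 0 pz))

termP-∸ : ∀ lv z pz pxz i →
  termP lv (z , pz , pxz) i ≡ μcoef (lv ∸ length z) 0 pz ℤ.* shift (suc (lv ∸ length z) / 2) pxz i
termP-∸ lv z pz pxz i with length z ≤? lv
... | yes h rewrite +-∸-assoc 1 h = refl
-- For z longer than v the truncated gap is 0, and μ vanishes on both sides by parity.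
... | no ¬h rewrite m≤n⇒m∸n≡0 (<⇒≤ (≰⇒> ¬h)) = refl

termP-0 : ∀ lv z pz pxz → termP lv (z , pz , pxz) 0 ≡ 0ℤ
termP-0 lv z pz pxz = trans (termP-∸ lv z pz pxz 0) (μ-shift-0 (lv ∸ length z) pz pxz)

∸≡1⇒ : ∀ m n → m ∸ n ≡ 1 → m ≡ suc n
∸≡1⇒ m zero e = e
∸≡1⇒ (suc m) (suc n) e = cong suc (∸≡1⇒ m n e)

termP-1 : ∀ z pz pxz → termP (suc (length z)) (z , pz , pxz) 1 ≡ pz 0 ℤ.* pxz 0
termP-1 z pz pxz = trans (termP-∸ (suc (length z)) z pz pxz 1)
  (cong (λ d → μcoef d 0 pz ℤ.* shift (suc d / 2) pxz 1) (ℕₚ.m+n∸n≡m 1 (length z)))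

termP-1-zero : ∀ lv z pz pxz → lv ≢ suc (length z) → termP lv (z , pz , pxz) 1 ≡ 0ℤ
termP-1-zero lv z pz pxz ≢ = trans (termP-∸ lv z pz pxz 1)
  (μ-shift-1 (lv ∸ length z) pz pxz (≢ ∘ ∸≡1⇒ lv (length z)))

sumTerms-zero : ∀ lv i {ts} → All (λ τ → termP lv τ i ≡ 0ℤ) ts → sumTerms lv ts i ≡ 0ℤ
sumTerms-zero lv i [] = refl
sumTerms-zero lv i (e ∷ es) = cong₂ ℤ._+_ e (sumTerms-zero lv i es)

-- `Any` supplies a representative of `z₀` in the list, and `AllPairs` excludes a second one.
sumTerms-single : ∀ lv i {ts} z₀ K →
  All (λ τ → (proj₁ τ ~ z₀ → termP lv τ i ≡ K) × (¬ proj₁ τ ~ z₀ → termP lv τ i ≡ 0ℤ)) ts →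
  Any (λ τ → proj₁ τ ~ z₀) ts →
  AllPairs (λ τ τ′ → ¬ (proj₁ τ ~ proj₁ τ′)) ts →
  sumTerms lv ts i ≡ K
sumTerms-single lv i z₀ K ((f , _) ∷ as) (here p) (apart ∷ _) =
  trans (cong₂ ℤ._+_ (f p) (sumTerms-zero lv i (others as apart))) (ℤₚ.+-identityʳ K)
  where
  others : ∀ {ts} →
    All (λ τ → (proj₁ τ ~ z₀ → termP lv τ i ≡ K) × (¬ proj₁ τ ~ z₀ → termP lv τ i ≡ 0ℤ)) ts →
    All (λ τ′ → ¬ (_ ~ proj₁ τ′)) ts → All (λ τ → termP lv τ i ≡ 0ℤ) ts
  others [] [] = []
  others ((_ , g) ∷ as) (¬q ∷ qs) = g (λ q → ¬q (~trans p (~sym q))) ∷ others as qs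
sumTerms-single lv i z₀ K ((_ , g) ∷ as) (there q) (apart ∷ ps) =
  trans (cong₂ ℤ._+_ (g (λ p → head-apart p apart q)) (sumTerms-single lv i z₀ K as q ps)) (ℤₚ.+-identityˡ K)
  where
  head-apart : ∀ {ts z} → z ~ z₀ → All (λ τ′ → ¬ (z ~ proj₁ τ′)) ts → ¬ Any (λ τ → proj₁ τ ~ z₀) ts
  head-apart p (¬q ∷ _) (here q) = ¬q (~trans p (~sym q))
  head-apart p (_ ∷ qs) (there q) = head-apart p qs q

-- The summands have no constant term. Of the two leading polynomials only the unshifted one
-- survives, namely that of `down σ x`, which is how `LE` recurses.
KL-coeff-0 : ∀ {x y p} → KL x y p → p 0 ≡ χ x y
KL-coeff-0 {x} (KL-e x~[]) = sym (χ-LE {x} {[]} (ℓ-cong x~[]))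
KL-coeff-0 {x} (KL-ne x≁[]) = sym (χ-¬LE {x} {[]} (λ e → x≁[] (LE⇒~ [] e z≤n)))
KL-coeff-0 {x} {σ ∷ v} (KL-step {c = c} {p₁} {p₂} ts _ c₁ c₀ k₁ k₂ _ _ _) = begin
  (shift (1 ∸ c) p₁ 0 ℤ.+ shift c p₂ 0) ℤ.- sumTerms (length v) ts 0
    ≡⟨ cong (λ i → (shift (1 ∸ c) p₁ 0 ℤ.+ shift c p₂ 0) ℤ.- i)
            (sumTerms-zero (length v) 0 (All.universal (λ (z , pz , pxz) → termP-0 (length v) z pz pxz) ts)) ⟩
  (shift (1 ∸ c) p₁ 0 ℤ.+ shift c p₂ 0) ℤ.+ 0ℤ
    ≡⟨ ℤₚ.+-identityʳ _ ⟩
  shift (1 ∸ c) p₁ 0 ℤ.+ shift c p₂ 0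
    ≡⟨ main (D? σ x) ⟩
  χ (down σ x) v ∎
  where
  open ≡-Reasoning
  main : Dec (D σ x) → shift (1 ∸ c) p₁ 0 ℤ.+ shift c p₂ 0 ≡ χ (down σ x) v
  main (yes d) rewrite c₁ (D⇒LeftDesc d) | down-D d = trans (ℤₚ.+-identityʳ _) (KL-coeff-0 k₁)
  main (no ¬d) rewrite c₀ (¬d ∘ LeftDesc⇒D) | down-¬D ¬d = trans (ℤₚ.+-identityˡ _) (KL-coeff-0 k₂)

-- The contribution of the sum over z to the coefficient of q in P_{x,w}, for
-- w = cyc a b c (1 + N).
correction : Gen → Gen → Gen → ℕ → Word → ℤ
correction a b c (suc (suc (suc (suc k)))) x = χ x (coatom b c a k)
correction a b c _ x = 0ℤ

module _ {a b c : Gen} {x : Word} (δ : Distinct a b c) where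

  Summand : ℕ → Term → Set
  Summand N (z , pz , pxz) =
    IsReduced z × z <B cyc b c a N × LeftDesc a z × KL z (cyc b c a N) pz × KL x z pxz

  -- A contribution requires length gap 1 and z ≤ v. Since a is the cyclic predecessor of the first
  -- letter of v, `coatom-pred` leaves one candidate.
  summand-1 : ∀ N τ → Summand N τ → termP N τ 1 ≢ 0ℤ →
    Σ ℕ λ k → N ≡ 4 + k × proj₁ τ ~ coatom b c a k
  summand-1 N (z , pz , pxz) (ρ , _ , da , kz , _) ≢0 with N ℕₚ.≟ suc (length z)
  ... | no N≢ = contradiction (termP-1-zero N z pz pxz N≢) ≢0
  ... | yes refl with LE? z (cyc b c a N)
  ...   | no ¬h = contradiction
            (trans (termP-1 z pz pxz)
              (cong (ℤ._* pxz 0) (trans (KL-coeff-0 kz) (χ-¬LE {z} {cyc b c a N} ¬h)))) ≢0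
  ...   | yes h with coatom-pred (length z) (rotate δ) h (ℓ≡length (IsReduced⇒Reduced ρ)) (LeftDesc⇒D da)
  ...     | k , e , p = k , cong suc e , p

  summand-coatom : ∀ k τ → Summand (4 + k) τ → proj₁ τ ~ coatom b c a k →
    termP (4 + k) τ 1 ≡ χ x (coatom b c a k)
  summand-coatom k (z , pz , pxz) (ρ , _ , da , kz , kxz) p = begin
    termP (4 + k) (z , pz , pxz) 1           ≡⟨ cong (λ n → termP n (z , pz , pxz) 1) |z| ⟨
    termP (suc (length z)) (z , pz , pxz) 1  ≡⟨ termP-1 z pz pxz ⟩
    pz 0 ℤ.* pxz 0                           ≡⟨ cong (ℤ._* pxz 0) (trans (KL-coeff-0 kz) z≤v) ⟩
    1ℤ ℤ.* pxz 0                             ≡⟨ ℤₚ.*-identityˡ (pxz 0) ⟩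
    pxz 0                                    ≡⟨ KL-coeff-0 kxz ⟩
    χ x z                                    ≡⟨ χ-congʳ {x} (IsReduced⇒Reduced ρ) (coatom-reduced (rotate δ) k) p ⟩
    χ x (coatom b c a k)                     ∎
    where
    open ≡-Reasoning
    |z| : suc (length z) ≡ 4 + k
    |z| = cong suc (trans (sym (ℓ≡length (IsReduced⇒Reduced ρ))) (trans (ℓ-cong p) (ℓ-coatom (rotate δ) k)))
    z≤v : χ z (cyc b c a (4 + k)) ≡ 1ℤ
    z≤v = χ-LE {z} {cyc b c a (4 + k)} (coatom-LE (rotate δ) k p)

  sumTerms-1 : ∀ N ts → All (Summand N) ts →
    (∀ z → z <B cyc b c a N → LeftDesc a z → Any (λ τ → proj₁ τ ~ z) ts) →
    AllPairs (λ τ τ′ → ¬ (proj₁ τ ~ proj₁ τ′)) ts →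
    sumTerms N ts 1 ≡ correction a b c N x
  sumTerms-1 N ts al complete apart = cases N al complete apart
    where
    vanish : ∀ {N τ} → Summand N τ → (∀ k → N ≡ 4 + k → ¬ proj₁ τ ~ coatom b c a k) → termP N τ 1 ≡ 0ℤ
    vanish {N} {τ} h ¬p with termP N τ 1 ℤₚ.≟ 0ℤ
    ... | yes e = e
    ... | no ≢0 with summand-1 N τ h ≢0
    ...   | k , e , p = contradiction p (¬p k e)

    small : ∀ {N} → (∀ k → N ≢ 4 + k) → All (Summand N) ts → sumTerms N ts 1 ≡ 0ℤ
    small {N} N≢ al = sumTerms-zero N 1 (All.map (λ h → vanish h λ k e → contradiction e (N≢ k)) al)

    cases : ∀ N → All (Summand N) ts →
      (∀ z → z <B cyc b c a N → LeftDesc a z → Any (λ τ → proj₁ τ ~ z) ts) →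
      AllPairs (λ τ τ′ → ¬ (proj₁ τ ~ proj₁ τ′)) ts →
      sumTerms N ts 1 ≡ correction a b c N x
    cases 0 al _ _ = small (λ _ ()) al
    cases 1 al _ _ = small (λ _ ()) al
    cases 2 al _ _ = small (λ _ ()) al
    cases 3 al _ _ = small (λ _ ()) al
    cases (suc (suc (suc (suc k)))) al complete apart =
      sumTerms-single (4 + k) 1 (coatom b c a k) _
        (All.map (λ {τ} h → summand-coatom k τ h , λ ¬p → vanish h λ { _ refl → ¬p }) al)
        (complete _ (coatom-<B (rotate δ) k) (D⇒LeftDesc (coatom-D (rotate δ) k)))
        apart

-- Of the two leading polynomials, the one shifted by q contributes its constant term, known from
-- `KL-coeff-0`; the other contributes its own coefficient of q.
KL-coeff-1 : ∀ {a b c} → Distinct a b c → ∀ N {x p} → KL x (cyc a b c (suc N)) p →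
  ∃₂ λ p₁ p₂ → KL (a ∷ x) (cyc b c a N) p₁ × KL x (cyc b c a N) p₂ ×
    (D a x → p 1 ≡ (p₁ 1 ℤ.+ χ x (cyc b c a N)) ℤ.- correction a b c N x) ×
    (¬ D a x → p 1 ≡ (χ (a ∷ x) (cyc b c a N) ℤ.+ p₂ 1) ℤ.- correction a b c N x)
KL-coeff-1 {a} {b} {c} δ N {x} (KL-step {c = e} {p₁} {p₂} ts _ c₁ c₀ k₁ k₂ al complete apart) =
  p₁ , p₂ , k₁ , k₂ , step₁ , step₀
  where
  sum≡ : sumTerms (length (cyc b c a N)) ts 1 ≡ correction a b c N x
  sum≡ = trans (cong (λ n → sumTerms n ts 1) (length-cyc b c a N)) (sumTerms-1 δ N ts al complete apart)
  step₁ : D a x → (shift (1 ∸ e) p₁ 1 ℤ.+ shift e p₂ 1) ℤ.- sumTerms (length (cyc b c a N)) ts 1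
          ≡ (p₁ 1 ℤ.+ χ x (cyc b c a N)) ℤ.- correction a b c N x
  step₁ d rewrite c₁ (D⇒LeftDesc d) = cong₂ ℤ._-_ (cong (λ i → p₁ 1 ℤ.+ i) (KL-coeff-0 k₂)) sum≡
  step₀ : ¬ D a x → (shift (1 ∸ e) p₁ 1 ℤ.+ shift e p₂ 1) ℤ.- sumTerms (length (cyc b c a N)) ts 1
          ≡ (χ (a ∷ x) (cyc b c a N) ℤ.+ p₂ 1) ℤ.- correction a b c N x
  step₀ ¬d rewrite c₀ (¬d ∘ LeftDesc⇒D) = cong₂ ℤ._-_ (cong (ℤ._+ p₂ 1) (KL-coeff-0 k₁)) sum≡

-- Carrying `N ≡ 4 + k` in the hypotheses treats all N at once: for N < 4 the first one says that y
-- ≤ v fails, matching the correction 0.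
correction-⇔ : ∀ {a b c} N {x y} →
  (LE y (cyc b c a N) → Σ ℕ λ k → N ≡ 4 + k × LE x (coatom b c a k)) →
  (∀ k → N ≡ 4 + k → LE x (coatom b c a k) → LE y (cyc b c a N)) →
  χ y (cyc b c a N) ≡ correction a b c N x
correction-⇔ {a} {b} {c} 0 {x} {y} f _ = χ-¬LE {y} {[]} λ h → case f h of λ ()
correction-⇔ {a} {b} {c} 1 {x} {y} f _ = χ-¬LE {y} {cyc b c a 1} λ h → case f h of λ ()
correction-⇔ {a} {b} {c} 2 {x} {y} f _ = χ-¬LE {y} {cyc b c a 2} λ h → case f h of λ ()
correction-⇔ {a} {b} {c} 3 {x} {y} f _ = χ-¬LE {y} {cyc b c a 3} λ h → case f h of λ ()
correction-⇔ {a} {b} {c} (suc (suc (suc (suc k)))) {x} {y} f g =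
  χ-⇔ {y} {cyc b c a (4 + k)} {x} {coatom b c a k}
    (λ h → case f h of λ { (_ , refl , q) → q }) (g k refl)

cancel-correctionˡ : ∀ i j {k l} → i ≡ 0ℤ → j ≡ k → l ≡ (i ℤ.+ j) ℤ.- k → l ≡ 0ℤ
cancel-correctionˡ _ j refl refl e = trans e (trans (cong (ℤ._- j) (ℤₚ.+-identityˡ j)) (ℤₚ.+-inverseʳ j))

cancel-correctionʳ : ∀ i j {k l} → i ≡ 0ℤ → j ≡ k → l ≡ (j ℤ.+ i) ℤ.- k → l ≡ 0ℤ
cancel-correctionʳ _ j refl refl e = trans e (trans (cong (ℤ._- j) (ℤₚ.+-identityʳ j)) (ℤₚ.+-inverseʳ j))

-- The case of the degree bound needed here. By induction the coefficient from v vanishes, and by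
-- length the two Bruhat conditions agree: the only coatom of v with a as a descent is the one in
-- the correction.
coeff-1-near : ∀ n {a b c x p} → Distinct a b c → KL x (cyc a b c n) p → n ≤ 2 + ℓ x → p 1 ≡ 0ℤ
coeff-1-near zero _ (KL-e _) _ = refl
coeff-1-near zero _ (KL-ne _) _ = refl
coeff-1-near (suc N) {a} {b} {c} {x} {p} δ K N≤ with KL-coeff-1 δ N K
... | p₁ , p₂ , k₁ , k₂ , step₁ , step₀ = main (D? a x)
  where
  v = cyc b c a N
  δ′ = rotate δ
  N≤1+ℓ : N ≤ suc (ℓ x)
  N≤1+ℓ = s≤s⁻¹ N≤

  LE-coatom⇒~ : ∀ k → N ≡ 4 + k → LE x (coatom b c a k) → x ~ coatom b c a k
  LE-coatom⇒~ k refl h = LE⇒~ (coatom b c a k) h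
    (≤-trans (≤-reflexive (cong (suc ∘ suc ∘ suc) (length-cyc c a b k))) (s≤s⁻¹ N≤1+ℓ))

  N≢ℓ : ∀ {y} → LE y v → D a y → N ≢ ℓ y
  N≢ℓ {y} h d e = cyc-¬D-pred δ′ N
    (D-cong (LE⇒~ v h (≤-reflexive (trans (length-cyc b c a N) e))) d)

  main : Dec (D a x) → p 1 ≡ 0ℤ
  main (yes d) = cancel-correctionˡ (p₁ 1) (χ x v)
    (coeff-1-near N δ′ k₁ (≤-trans N≤1+ℓ (s≤s (≤-reflexive (sym (D-suc d))))))
    (correction-⇔ N {x} {x} forth (λ { k refl h → coatom-LE δ′ k (LE-coatom⇒~ k refl h) }))
    (step₁ d)
    where
    forth : LE x v → Σ ℕ λ k → N ≡ 4 + k × LE x (coatom b c a k)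
    forth h = top (m≤n⇒m<n∨m≡n (≤-trans (LE⇒ℓ≤ v h) (≤-reflexive (length-cyc b c a N))))
      where
      top : ℓ x < N ⊎ ℓ x ≡ N → Σ ℕ λ k → N ≡ 4 + k × LE x (coatom b c a k)
      top (inj₂ e) = contradiction (sym e) (N≢ℓ h d)
      top (inj₁ <N) with coatom-pred (ℓ x) δ′ (subst (λ n → LE x (cyc b c a n)) N≡ h) refl d
        where N≡ = ≤-antisym N≤1+ℓ <N
      ... | k , e , q = k , trans (≤-antisym N≤1+ℓ <N) (cong suc e) , LE-refl (coatom-reduced δ′ k) q
  -- Both Bruhat conditions fail: by length they would be equalities, making a a descent of v or of
  -- x.
  main (no ¬d) = cancel-correctionʳ (p₂ 1) (χ (a ∷ x) v)
    (coeff-1-near N δ′ k₂ (m≤n⇒m≤1+n N≤1+ℓ))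
    (correction-⇔ N {x} {a ∷ x}
      (λ h → contradiction (≤-antisym (≤-trans N≤1+ℓ (≤-reflexive (sym (¬D-suc ¬d))))
                                      (≤-trans (LE⇒ℓ≤ v h) (≤-reflexive (length-cyc b c a N))))
                           (N≢ℓ h (¬D⇒D-∷ ¬d)))
      (λ k e h → contradiction (D-cong (~sym (LE-coatom⇒~ k e h)) (coatom-D δ′ k)) ¬d))
    (step₀ ¬d)

coeff-1-≢0 : ∀ n {a b c x p} → Distinct a b c → KL x (cyc a b c n) p → 3 + ℓ x ≡ n → p 1 ≢ 0ℤ →
  x ~ cyc a b c (ℓ x) ⊎ (Σ ℕ λ k → n ≡ 2 + even≥4 k × x ~ zig c a b k × D a x × D c x)
coeff-1-≢0 (suc N) {a} {b} {c} {x} {p} δ K ℓ≡ ≢0 with KL-coeff-1 δ N K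
... | p₁ , p₂ , k₁ , k₂ , step₁ , step₀ = main (D? a x)
  where
  v = cyc b c a N
  δ′ = rotate δ
  Claim : Set
  Claim = x ~ cyc a b c (ℓ x) ⊎ (Σ ℕ λ k → suc N ≡ 2 + even≥4 k × x ~ zig c a b k × D a x × D c x)

  N≡ : N ≡ 2 + ℓ x
  N≡ = sym (suc-injective ℓ≡)

  descend : D a x → Dec (p₁ 1 ≡ 0ℤ) → Claim
  descend d (no ≢0₁)
    with coeff-1-≢0 N δ′ k₁ (trans (cong (suc ∘ suc) (D-suc d)) (sym N≡)) ≢0₁
  ... | inj₁ q = inj₁ (~trans (move q) (~-reflexive (cong (cyc a b c) (D-suc d))))
  -- For v the zigzag alternative names a, the predecessor of its first letter b, as a descent of
  -- `a ∷ x`.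
  ... | inj₂ (_ , _ , _ , _ , d′) = contradiction d′ (D⇒¬D-∷ d)
  descend d (yes ≡0) = by-length (ℓ x) refl N≡
    where
    by-length : ∀ m → ℓ x ≡ m → N ≡ 2 + m → Claim
    by-length zero e _ = contradiction (trans (D-suc d) e) λ ()
    by-length (suc zero) e _ = inj₁ (~trans
      (move (LE⇒~ [] (suc-injective (trans (D-suc d) e)) z≤n)) (~-reflexive (cong (cyc a b c) (sym e))))
    by-length (suc (suc k)) e refl = cases (D? b x) (D? c (b ∷ x)) (LE? x (c ∷ z)) (LE? x z)
      where
      -- With this z, v is b c z and the coatom is b z, so the two Bruhat conditions differ only by
      -- the letter c.
      z = cyc a b c (2 + k)
      v≢coatom : χ x v ≢ χ x (coatom b c a k)
      v≢coatom eq = ≢0 (cancel-correctionˡ (p₁ 1) (χ x v) ≡0 eq (step₁ d))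
      ~prefix : x ~ z → Claim
      ~prefix q = inj₁ (~trans q (~-reflexive (cong (cyc a b c) (sym e))))
      cases : Dec (D b x) → Dec (D c (b ∷ x)) → Dec (LE x (c ∷ z)) → Dec (LE x z) → Claim
      cases (yes db) (yes dc) _ _ = contradiction dc
        (no-cyclic-descents (ℓ x) x ≤-refl (≢-sym (proj₁ δ) , proj₂ (proj₂ δ) , proj₁ (proj₂ δ)) db d)
      cases (yes db) (no ¬dc) _ _ = contradiction
        (χ-⇔ {x} {v} {x} {coatom b c a k}
          (λ h → LE-D⁻ z db (LE-¬D z ¬dc (LE-D (c ∷ z) db h)))
          (λ h → LE-D⁻ (c ∷ z) db (LE-¬D⁻ z ¬dc (LE-D z db h))))
        v≢coatom
      -- Now x has one letter less than the cyclic word `c ∷ z` above it, and the second letter a of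
      -- that word is a descent of x.
      cases (no ¬db) _ (yes h) _ with coatom-succ (2 + k) (rotate δ′) h e d
      ... | inj₁ q = ~prefix q
      ... | inj₂ (j , e′ , q , dc) = inj₂ (j , cong (suc ∘ suc) e′ , q , d , dc)
      cases (no ¬db) _ (no ¬h) (yes h) =
        ~prefix (LE⇒~ z h (≤-reflexive (trans (length-cyc a b c (2 + k)) (sym e))))
      cases (no ¬db) _ (no ¬h) (no ¬h′) = contradiction
        (χ-⇔ {x} {v} {x} {coatom b c a k}
          (λ h → contradiction (LE-¬D (c ∷ z) ¬db h) ¬h)
          (λ h → contradiction (LE-¬D z ¬db h) ¬h′))
        v≢coatom

  main : Dec (D a x) → Claim
  main (yes d) = descend d (p₁ 1 ℤₚ.≟ 0ℤ)
  -- Both Bruhat conditions amount to x ~ b a w with w = `cyc c a b k`: the coatom is b a b w ~ a b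
  -- a w, and a is no descent of x.
  main (no ¬d) = contradiction (cancel-correctionʳ (p₂ 1) (χ (a ∷ x) v)
      (coeff-1-near N δ′ k₂ (≤-reflexive N≡)) (correction-⇔ N {x} {a ∷ x} forth back) (step₀ ¬d)) ≢0
    where
    forth : LE (a ∷ x) v → Σ ℕ λ k → N ≡ 4 + k × LE x (coatom b c a k)
    forth h with coatom-pred (suc (ℓ x)) δ′ (subst (λ n → LE (a ∷ x) (cyc b c a n)) N≡ h) (¬D-suc ¬d) (¬D⇒D-∷ ¬d)
    ... | k , e , q = k , trans N≡ (cong suc e) , LE-braid {x = x} w (proj₁ δ)
      (LE-¬D⁻ (b ∷ a ∷ w) ¬d
        (LE-refl (reduced-tail (coatom-braid-reduced δ′ k)) (∷-injective-~ (~trans q (coatom-braid δ′ k)))))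
      where w = cyc c a b k
    back : ∀ k → N ≡ 4 + k → LE x (coatom b c a k) → LE (a ∷ x) v
    back k refl h = coatom-LE δ′ k (~trans (∷-cong a x~) (~sym (coatom-braid δ′ k)))
      where
      w = cyc c a b k
      x~ : x ~ b ∷ a ∷ w
      x~ = LE⇒~ (b ∷ a ∷ w) (LE-¬D (b ∷ a ∷ w) ¬d (LE-braid {x = x} w (≢-sym (proj₁ δ)) h))
        (≤-reflexive (trans (cong (suc ∘ suc) (length-cyc c a b k)) (suc-injective (suc-injective N≡))))

-- Descents on both sides

length-zig : ∀ a b c k → suc (length (zig a b c k)) ≡ even≥4 k
length-zig a b c zero = refl
length-zig a b c (suc k) = cong (suc ∘ suc) (length-zig c a b k)

-- The ending x y z x of the cyclic word loses z. So x and y will be the right descents of the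
-- zigzag, while z and x are the last two letters of w.
zig-suffix : ∀ {a b c} → Distinct a b c → ∀ k → Σ Word λ q → Σ Gen λ x → Σ Gen λ y → Σ Gen λ z →
  Distinct x y z × zig a b c k ≡ q ++ x ∷ y ∷ x ∷ [] ×
  cyc a b c (even≥4 k) ≡ (q ++ x ∷ y ∷ []) ++ z ∷ x ∷ []
zig-suffix {a} {b} {c} δ zero = [] , a , b , c , δ , refl , refl
zig-suffix {a} {b} {c} δ (suc k) with zig-suffix (rotate (rotate δ)) k
... | q , x , y , z , δ′ , e , f = a ∷ b ∷ q , x , y , z , δ′ ,
      cong (λ u → a ∷ b ∷ u) e , cong (λ u → a ∷ b ∷ u) f

last-two : ∀ p p′ {a b a′ b′ : Gen} → p ++ a ∷ b ∷ [] ≡ p′ ++ a′ ∷ b′ ∷ [] → a ≡ a′ × b ≡ b′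
last-two p p′ {a} {b} {a′} {b′} e
  with ∷-injective (trans (sym (reverse-++ p (a ∷ b ∷ [])))
                   (trans (cong reverse e) (reverse-++ p′ (a′ ∷ b′ ∷ []))))
... | b≡ , e′ = proj₁ (∷-injective e′) , b≡

Card2-D : ∀ {a b c} {P : Gen → Set} {x} → Distinct a b c → (∀ {σ} → P σ → D σ x) →
  (∀ {σ} → D σ x → P σ) → D a x → D b x → Card2 P × P a × P b × ¬ P c
Card2-D {a} {b} {c} {P} {x} δ P⇒D D⇒P da db =
  (a , b , proj₁ δ , D⇒P da , D⇒P db , only) , D⇒P da , D⇒P db , ¬c
  where
  ¬c : ¬ P c
  ¬c pc = at-most-two-descents x δ da db (P⇒D pc)
  only : ∀ ρ → P ρ → ρ ≡ a ⊎ ρ ≡ b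
  only ρ pρ with gen-cases δ ρ
  ... | inj₁ e = inj₁ e
  ... | inj₂ (inj₁ e) = inj₂ e
  ... | inj₂ (inj₂ refl) = contradiction pρ ¬c

zig-right-descents : ∀ {x y u} q → x ≢ y → u ~ q ++ x ∷ y ∷ x ∷ [] →
  ℓ u ≡ length (q ++ x ∷ y ∷ x ∷ []) → D x (reverse u) × D y (reverse u)
zig-right-descents {x} {y} {u} q x≢y u~ ℓu =
  D-cong (~sym rev~) (reduced-head ρ) ,
  D-cong (~sym (~trans rev~ (braid₀ _ x≢y))) (reduced-head ρ′)
  where
  word≡ : reverse (q ++ x ∷ y ∷ x ∷ []) ≡ x ∷ y ∷ x ∷ reverse q
  word≡ = reverse-++ q (x ∷ y ∷ x ∷ [])
  rev~ : reverse u ~ x ∷ y ∷ x ∷ reverse q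
  rev~ = ~trans (reverse-cong u~) (~-reflexive word≡)
  ρ : Reduced (x ∷ y ∷ x ∷ reverse q)
  ρ = red (trans (ℓ-cong (~sym rev~)) (trans (ℓ-reverse u) (trans ℓu
        (trans (sym (length-reverse (q ++ x ∷ y ∷ x ∷ []))) (cong length word≡)))))
  ρ′ : Reduced (y ∷ x ∷ y ∷ reverse q)
  ρ′ = red (trans (ℓ-cong (~sym (braid₀ (reverse q) x≢y))) (ℓ≡length ρ))

-- Words in which any three consecutive letters are distinct

Avoiding : Word → Set
Avoiding w = (∀ p q x → w ≢ p ++ x ∷ x ∷ q) × (∀ p q x y → w ≢ p ++ x ∷ y ∷ x ∷ q)

-- A square could be cancelled, and a braid move on a factor x y x would produce a second reduced
-- expression.
C1⇒Avoiding : ∀ {w} → IsReduced w → InC1 w → Avoiding w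
C1⇒Avoiding {w} min (_ , y₀ , _ , _ , uniq) = no-square , no-braid
  where
  no-square : ∀ p q x → w ≢ p ++ x ∷ x ∷ q
  no-square p q x refl = contradiction (min (p ++ q) (~sym (cancel p q x)))
    (ℕₚ.<⇒≱ (subst₂ _<_ (sym (length-++ p)) (sym (length-++ p))
      (ℕₚ.+-monoʳ-< (length p) (n≤1+n (suc (length q))))))
  no-braid : ∀ p q x y → w ≢ p ++ x ∷ y ∷ x ∷ q
  no-braid p q x y refl with x ≟ y
  ... | yes refl = no-square p (x ∷ q) x refl
  ... | no x≢y = x≢y (sym (proj₁ (∷-injective (++-cancelˡ p _ _ (trans (uniq w′ min′ w′~w) (sym (uniq w min ~refl)))))))
    where
    w′ = p ++ y ∷ x ∷ y ∷ q
    w′~w : w′ ~ w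
    w′~w = braid p q y x (≢-sym x≢y)
    min′ : IsReduced w′
    min′ z z~ = ≤-trans (≤-reflexive (trans (length-++ p) (sym (length-++ p)))) (min z (~trans z~ w′~w))

Avoiding-tail : ∀ {σ w} → Avoiding (σ ∷ w) → Avoiding w
Avoiding-tail {σ} (f , g) =
  (λ p q x e → f (σ ∷ p) q x (cong (σ ∷_) e)) , (λ p q x y e → g (σ ∷ p) q x y (cong (σ ∷_) e))

Avoiding⇒cyc : ∀ {a b c} rest → Distinct a b c → Avoiding (a ∷ b ∷ c ∷ rest) →
  a ∷ b ∷ c ∷ rest ≡ cyc a b c (3 + length rest)
Avoiding⇒cyc [] δ _ = refl
Avoiding⇒cyc {a} {b} {c} (d ∷ rest) δ av@(f , g) with gen-cases δ d
... | inj₁ refl = cong (a ∷_) (Avoiding⇒cyc rest (rotate δ) (Avoiding-tail av))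
... | inj₂ (inj₁ refl) = contradiction refl (g (a ∷ []) rest b c)
... | inj₂ (inj₂ refl) = contradiction refl (f (a ∷ b ∷ []) rest c)

theorem5p7 : (w : Word) (s₁ s₂ s₃ sₘ sₙ : Gen) (rest pre : List Gen) →
    InC1 w → IsReduced w →
    w ≡ s₁ ∷ s₂ ∷ s₃ ∷ rest → w ≡ pre ++ sₘ ∷ sₙ ∷ [] →
    s₁ ≢ s₂ → s₂ ≢ s₃ → s₁ ≢ s₃ →
    (u : Word) (k : ℕ) → InC0 u → u <B w → Len u k → k + 3 ≡ length w →
    MuNonzero u w →
    Card2 (λ σ → LeftDesc σ u) × Card2 (λ σ → RightDesc σ u) ×
    LeftDesc s₁ u × RightDesc sₙ u × ¬ LeftDesc s₂ u × ¬ RightDesc sₘ u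
theorem5p7 w s₁ s₂ s₃ sₘ sₙ rest pre w∈c₁ red-w w≡ w≡pre s₁≢s₂ s₂≢s₃ s₁≢s₃
  u k (u≁[] , u∉c₁) _ len-u k+3≡ (lu , p , len-u′ , K , μ≢0) =
  conclude (coeff-1-≢0 n δ (subst (λ v → KL u v p) w≡cyc K) ℓu p₁≢0)
  where
  δ : Distinct s₁ s₂ s₃
  δ = s₁≢s₂ , s₂≢s₃ , s₁≢s₃
  n = 3 + length rest
  w≡cyc : w ≡ cyc s₁ s₂ s₃ n
  w≡cyc = trans w≡ (Avoiding⇒cyc rest δ (subst Avoiding w≡ (C1⇒Avoiding red-w w∈c₁)))
  ℓu : 3 + ℓ u ≡ n
  ℓu = trans (cong (λ i → 3 + i) (sym (Len⇒ℓ len-u)))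
         (trans (+-comm 3 k) (trans k+3≡ (cong length w≡)))
  |w|≡ : length w ≡ 3 + lu
  |w|≡ = trans (cong length w≡) (trans (sym ℓu) (cong (λ i → 3 + i) (sym (Len⇒ℓ len-u′))))
  p₁≢0 : p 1 ≢ 0ℤ
  -- For length gap 3, μ is the coefficient of q to the power (3 - 1)/2 = 1.
  p₁≢0 e = μ≢0 (trans (cong (λ i → μcoef i lu p) |w|≡) (trans μ≡p₁ e))
    where
    μ≡p₁ : μcoef (3 + lu) lu p ≡ p 1
    μ≡p₁ rewrite ℕₚ.m+n∸n≡m 3 lu = refl

  conclude : u ~ cyc s₁ s₂ s₃ (ℓ u) ⊎
      (Σ ℕ λ j → n ≡ 2 + even≥4 j × u ~ zig s₃ s₁ s₂ j × D s₁ u × D s₃ u) →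
    Card2 (λ σ → LeftDesc σ u) × Card2 (λ σ → RightDesc σ u) ×
    LeftDesc s₁ u × RightDesc sₙ u × ¬ LeftDesc s₂ u × ¬ RightDesc sₘ u
  -- A prefix of w is again cyclic, so it has a unique reduced expression and cannot lie in c₀.
  conclude (inj₁ u~) = contradiction (u≁[] , cyc-UniqueRedExpr δ (ℓ u) u~) u∉c₁
  conclude (inj₂ (j , n≡ , u~ , d₁ , d₃))
    with zig-suffix (rotate (rotate δ)) j
  ... | q , x , y , z , δ′ , zig≡ , cyc≡
    with zig-right-descents q (proj₁ δ′) (~trans u~ (~-reflexive zig≡)) ℓu≡
       | last-two pre (s₁ ∷ s₂ ∷ q ++ x ∷ y ∷ [])
           (trans (sym w≡pre) (trans w≡cyc (trans (cong (cyc s₁ s₂ s₃) n≡) (cong (λ v → s₁ ∷ s₂ ∷ v) cyc≡))))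
    where
    ℓu≡ : ℓ u ≡ length (q ++ x ∷ y ∷ x ∷ [])
    ℓu≡ = trans (suc-injective (suc-injective (suc-injective
            (trans ℓu (trans n≡ (cong (suc ∘ suc) (sym (length-zig s₃ s₁ s₂ j))))))))
            (cong length zig≡)
  -- Comparing the last two letters of w has identified sₘ with z and sₙ with x. Two known descents
  -- on each side exclude the third generator, s₂ on the left and z on the right.
  ... | dx , dy | refl , refl
    with Card2-D {P = λ σ → LeftDesc σ u} (s₁≢s₃ , ≢-sym s₂≢s₃ , s₁≢s₂) LeftDesc⇒D D⇒LeftDesc d₁ d₃
       | Card2-D {P = λ σ → RightDesc σ u} δ′ RightDesc⇒D D⇒RightDesc dx dy
  ... | left , l₁ , _ , ¬l₂ | right , rₙ , _ , ¬rₘ = left , right , l₁ , rₙ , ¬l₂ , ¬rₘ
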